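{- Let $q$ be an indeterminate, $[n]=1+q+\dots+q^{n-1}$, $[n]!=[1]\cdots[n]$, and let $e_n(q)\in\mathbb{Q}(q)$ ($n\ge1$) be the coefficients of the power product expansion $\sum_{n\ge0}\frac{x^n}{[n]!}=\prod_{n\ge1}(1+e_n(q)x^n)$. Let $u_n(q)=\prod_{j=1}^n\gcd([j],[n])$, where $\gcd$ denotes the monic greatest common divisor of polynomials, and set $r_n(q)=u_n(q)e_n(q)$. Then for every $n>1$, $(-1)^n r_n(q)$ is a polynomial in $q$ with integer coefficients and with leading coefficient $1$.
   Context: A power product expansion of a formal power series $f(x)=\sum_{n\ge0}a_nx^n$ with $a_0=1$ is the unique representation $f(x)=\prod_{n\ge1}(1+g_nx^n)$ (here over the field $\mathbb{Q}(q)$). -}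

module Defs where

open import Data.Nat as ℕ using (ℕ; zero; suc; _≤_; _<_)
open import Data.Integer as ℤ using (ℤ; +_)
open import Data.Rational as ℚ using (ℚ; 0ℚ; 1ℚ)
open import Data.List using (List; []; _∷_; map; replicate; _++_; last)
open import Data.List.Relation.Unary.All using (All)
open import Data.Maybe using (just)
open import Data.Product using (Σ; _×_; ∃-syntax)
open import Relation.Binary.PropositionalEquality using (_≡_)
open import Relation.Nullary using (¬_)

-- Generic dense polynomials: coefficient lists, lowest degree first.
-- Trailing zeros are allowed; equality is handled separately.

module PolyOps {A : Set} (0# : A) (_⊕_ _⊗_ : A → A → A) where
  addP : List A → List A → List A
  addP [] q = q
  addP (a ∷ p) [] = a ∷ p
  addP (a ∷ p) (b ∷ q) = (a ⊕ b) ∷ addP p q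

  scaleP : A → List A → List A
  scaleP a = map (a ⊗_)

  mulP : List A → List A → List A
  mulP [] q = []
  mulP (a ∷ p) q = addP (scaleP a q) (0# ∷ mulP p q)

  coeff : ℕ → List A → A
  coeff _ [] = 0#
  coeff zero (a ∷ _) = a
  coeff (suc k) (_ ∷ p) = coeff k p

Poly : Set
Poly = List ℚ

open PolyOps 0ℚ ℚ._+_ ℚ._*_ public
  renaming (addP to _+ₚ_; mulP to _*ₚ_; coeff to coeffₚ; scaleP to scaleₚ)

-ₚ_ : Poly → Poly
-ₚ_ = map (λ a → ℚ.- a)

_≈ₚ_ : Poly → Poly → Set
p ≈ₚ q = All (_≡ 0ℚ) (p +ₚ (-ₚ q))

_∣ₚ_ : Poly → Poly → Set
a ∣ₚ b = ∃[ c ] ((a *ₚ c) ≈ₚ b)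

-- monic: last stored coefficient is 1 (hence nonzero and the leading one)
Monic : Poly → Set
Monic d = last d ≡ just 1ℚ

IsMonicGcd : Poly → Poly → Poly → Set
IsMonicGcd a b d =
  Monic d × d ∣ₚ a × d ∣ₚ b × (∀ c → c ∣ₚ a → c ∣ₚ b → c ∣ₚ d)

qint : ℕ → Poly
qint n = replicate n 1ℚ

qfact : ℕ → Poly
qfact zero = 1ℚ ∷ []
qfact (suc n) = qfact n *ₚ qint (suc n)

prodTo : (ℕ → Poly) → ℕ → Poly
prodTo g zero = 1ℚ ∷ []
prodTo g (suc j) = prodTo g j *ₚ g (suc j)

signP : ℕ → Poly
signP zero = 1ℚ ∷ []
signP (suc n) = -ₚ signP n

-- ℚ(q) as formal fractions num/den (denominator nonzeroness is imposed
-- as a hypothesis where relevant)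

record Frac : Set where
  constructor _÷_
  field
    num : Poly
    den : Poly
open Frac public

_≈F_ : Frac → Frac → Set
(a ÷ b) ≈F (c ÷ d) = (a *ₚ d) ≈ₚ (c *ₚ b)

0F 1F : Frac
0F = [] ÷ (1ℚ ∷ [])
1F = (1ℚ ∷ []) ÷ (1ℚ ∷ [])

_+F_ : Frac → Frac → Frac
(a ÷ b) +F (c ÷ d) = ((a *ₚ d) +ₚ (c *ₚ b)) ÷ (b *ₚ d)

_*F_ : Frac → Frac → Frac
(a ÷ b) *F (c ÷ d) = (a *ₚ c) ÷ (b *ₚ d)

invQFact : ℕ → Frac
invQFact n = (1ℚ ∷ []) ÷ qfact n

module SerOps = PolyOps 0F _+F_ _*F_

factor : ℕ → Frac → List Frac
factor zero c = 1F +F c ∷ []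
factor (suc k) c = 1F ∷ (replicate k 0F ++ (c ∷ []))

prodFactors : (ℕ → Frac) → ℕ → List Frac
prodFactors e zero = 1F ∷ []
prodFactors e (suc n) = SerOps.mulP (prodFactors e n) (factor (suc n) (e (suc n)))

-- e (n ≥ 1) are the coefficients of the power product expansion
--   Σ_{n≥0} x^n/[n]! = ∏_{n≥1} (1 + e_n x^n).
-- The coefficient of x^N of the infinite product equals that of the
-- finite product over n = 1..N.
IsPPE-qexp : (ℕ → Frac) → Set
IsPPE-qexp e =
  (∀ n → 1 ≤ n → ¬ (den (e n) ≈ₚ []))
  × (∀ N → 1 ≤ N → SerOps.coeff N (prodFactors e N) ≈F invQFact N)

embedℤ : List ℤ → Poly
embedℤ = map (λ z → z ℚ./ 1)

MonicℤPoly : List ℤ → Set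
MonicℤPoly P = last P ≡ just (+ 1)

module Submission where

open import Defs
open import Algebra using (CommutativeRing)
open import Algebra.Morphism.Structures using (IsRingMonomorphism)
import Algebra.Morphism.RingMonomorphism as RingMonomorphism
import Algebra.Properties.CommutativeSemigroup.Divisibility
import Algebra.Properties.CommutativeSemiring.Exp
import Algebra.Properties.Monoid.Divisibility
import Algebra.Properties.Ring
import Algebra.Properties.Semiring.Exp
import Algebra.Solver.Ring.NaturalCoefficients.Default as NatSolver
open import Data.Integer as ℤ using (ℤ; +_)
import Data.Integer.Properties as ℤ
open import Data.List using (List; []; _∷_; map; replicate; _++_; length; last)
open import Data.List.Properties using (map-++; map-replicate)
open import Data.List.Relation.Unary.All using (All; []; _∷_)
open import Data.Maybe using (just)
open import Data.Nat as ℕ using (ℕ; zero; suc; _≤_; _<_; z≤n; s≤s)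
open import Data.Nat.Divisibility as ℕ using (divides) renaming (_∣_ to _∣ₙ_; _∤_ to _∤ₙ_; _∣?_ to _∣ₙ?_)
open import Data.Nat.GCD using (gcd; gcd-GCD; gcd[m,n]∣m; gcd[m,n]∣n; gcd-greatest; gcd[m,n]≢0; module Bézout)
open import Data.Nat.Induction using (<-rec)
import Data.Nat.Properties as ℕ
open import Data.Nat.Solver using (module +-*-Solver)
open import Data.Product using (_×_; _,_; proj₁; proj₂; ∃-syntax)
open import Data.Rational as ℚ using (ℚ; 0ℚ; 1ℚ)
import Data.Rational.Properties as ℚ
open import Data.Rational.Unnormalised as ℚᵘ using (mkℚᵘ; *≡*)
import Data.Rational.Unnormalised.Properties as ℚᵘ
open import Data.Sum using (_⊎_; inj₁; inj₂)
open import Level using (0ℓ)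
open import Relation.Binary.Definitions using (tri<; tri≈; tri>)
open import Relation.Binary.PropositionalEquality as ≡ using (_≡_; _≢_)
import Relation.Binary.Reasoning.Setoid as SetoidReasoning
open import Relation.Nullary using (Dec; ¬_; contradiction; yes; no)

-- Write F = Σ xⁿ/[n]!. Since F is its own q-derivative, x F′/F = Σ (1 − q)^(n−1)/[n] xⁿ, so
-- taking logarithmic derivatives of F = ∏ (1 + eₙ xⁿ) gives
--   Σ_{d ∣ n} (−1)^(n/d − 1) d e_d^(n/d) = (1 − q)^(n−1)/[n].
-- As gcd([j],[n]) = [gcd(j,n)], the product uₙ is divisible by [n] and by u_d^(n/d) for d ∣ n;
-- by induction uₙ eₙ is a polynomial over ℚ. Its leading term is visible in the same recursion:
-- the terms with 1 < d < n have too small a degree, and (1 − q)^(n−1) + (−1)ⁿ [n], coming from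
-- d = 1 and the right-hand side, has leading term (−1)ⁿ n q^(n−2).
-- The coefficients are integers because comparing coefficients in F = ∏ (1 + eₙ xⁿ) expresses
-- eₙ with a denominator that is a product of monic integer polynomials [k], and the quotient of
-- an integer polynomial by a monic one has integer coefficients.

-- Each of the two recursions misses what the other supplies. The one over divisors controls degrees
-- and leading coefficients but divides by n at every step, so on its own it stays over ℚ. The one
-- over coefficients of the product never divides by n, but its denominators D have no visible
-- relation to uₙ. They meet in D·rₙ = uₙ·p with D monic and D, uₙ, p integral. The invariant of the
-- divisor recursion is that rₙ has degree exactly one below uₙ. With m = n/d, the d-th term then
-- has degree deg uₙ - m, which for m ≥ 2 cannot reach deg uₙ - 1. The invariant fails at n = 1,
-- where u₁ = r₁ = 1; hence the term d = 1 is merged with the right-hand side by hand and the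
-- induction starts at 2. The factor n in the leading term of that merged part is exactly what the
-- division by n removes, leaving (-1)ⁿ.

-- Formal power series over a commutative ring.

module PowerSeries (R : CommutativeRing 0ℓ 0ℓ) where
  open CommutativeRing R
  open SetoidReasoning setoid
  open NatSolver commutativeSemiring using (solve; _:=_; _:+_; _:*_)

  Series : Set
  Series = ℕ → Carrier

  tl : Series → Series
  tl f k = f (suc k)

  infix 4 _≐_
  record _≐_ (f g : Series) : Set where
    constructor ext
    field at : ∀ k → f k ≈ g k
  open _≐_ public

  infixl 7 _⋆_
  infixl 6 _⊞_

  _⊞_ : Series → Series → Series
  (f ⊞ g) k = f k + g k

  -- The recursion along f = f 0 + x·`tl f` is the one that `mulP` runs on coefficient lists, so
  -- list multiplication translates by plain induction.
  _⋆_ : Series → Series → Series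
  (f ⋆ g) zero    = f 0 * g 0
  (f ⋆ g) (suc k) = f 0 * g (suc k) + (tl f ⋆ g) k

  zeroS oneS : Series
  zeroS _ = 0#
  oneS zero    = 1#
  oneS (suc _) = 0#

  negS : Series → Series
  negS f k = - f k

  -- The bounded form is what the finite products require, since they agree with F only up to a
  -- given degree.
  ⋆-cong≤ : ∀ k {f f′ g g′} → (∀ j → j ≤ k → f j ≈ f′ j) → (∀ j → j ≤ k → g j ≈ g′ j) →
            (f ⋆ g) k ≈ (f′ ⋆ g′) k
  ⋆-cong≤ zero p q = *-cong (p 0 z≤n) (q 0 z≤n)
  ⋆-cong≤ (suc k) p q = +-cong (*-cong (p 0 z≤n) (q (suc k) ℕ.≤-refl))
    (⋆-cong≤ k (λ j j≤k → p (suc j) (s≤s j≤k)) (λ j j≤k → q j (ℕ.m≤n⇒m≤1+n j≤k)))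

  ⋆-cong : ∀ {f f′ g g′} → f ≐ f′ → g ≐ g′ → f ⋆ g ≐ f′ ⋆ g′
  ⋆-cong p q = ext λ k → ⋆-cong≤ k (λ j _ → at p j) (λ j _ → at q j)

  ⋆-distribʳ : ∀ h f g → (f ⊞ g) ⋆ h ≐ f ⋆ h ⊞ g ⋆ h
  ⋆-distribʳ h f g = ext (go f g)
    where
    go : ∀ f g k → ((f ⊞ g) ⋆ h) k ≈ (f ⋆ h) k + (g ⋆ h) k
    go f g zero    = distribʳ _ _ _
    go f g (suc k) = trans (+-congˡ (go (tl f) (tl g) k))
      (solve 5 (λ a b c x y → (a :+ b) :* c :+ (x :+ y) := (a :* c :+ x) :+ (b :* c :+ y)) refl _ _ _ _ _)

  ⋆-scaleˡ : ∀ c f g → (λ k → c * f k) ⋆ g ≐ (λ k → c * (f ⋆ g) k)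
  ⋆-scaleˡ c f g = ext (go f)
    where
    go : ∀ f k → ((λ j → c * f j) ⋆ g) k ≈ c * (f ⋆ g) k
    go f zero    = *-assoc _ _ _
    go f (suc k) = trans (+-congˡ (go (tl f) k))
      (solve 4 (λ c a b x → c :* a :* b :+ c :* x := c :* (a :* b :+ x)) refl _ _ _ _)

  ⋆-zeroˡ : ∀ g → zeroS ⋆ g ≐ zeroS
  ⋆-zeroˡ g = ext go
    where
    go : ∀ k → (zeroS ⋆ g) k ≈ 0#
    go zero    = zeroˡ _
    go (suc k) = trans (+-cong (zeroˡ _) (go k)) (+-identityˡ _)

  ⋆-sucʳ : ∀ f g k → (f ⋆ g) (suc k) ≈ f (suc k) * g 0 + (f ⋆ tl g) k
  ⋆-sucʳ f g zero    = +-comm _ _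
  ⋆-sucʳ f g (suc k) = trans (+-congˡ (⋆-sucʳ (tl f) g k))
    (solve 3 (λ a b c → a :+ (b :+ c) := b :+ (a :+ c)) refl _ _ _)

  ⋆-comm : ∀ f g → f ⋆ g ≐ g ⋆ f
  ⋆-comm f g = ext (go f)
    where
    go : ∀ f k → (f ⋆ g) k ≈ (g ⋆ f) k
    go f zero    = *-comm _ _
    go f (suc k) = trans (+-cong (*-comm _ _) (go (tl f) k)) (sym (⋆-sucʳ g f k))

  ⋆-assoc : ∀ f g h → f ⋆ g ⋆ h ≐ f ⋆ (g ⋆ h)
  ⋆-assoc f g h = ext (go f)
    where
    go : ∀ f k → (f ⋆ g ⋆ h) k ≈ (f ⋆ (g ⋆ h)) k
    go f zero    = *-assoc _ _ _
    go f (suc k) = begin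
      f 0 * g 0 * h (suc k) + (((λ j → f 0 * tl g j) ⊞ tl f ⋆ g) ⋆ h) k
        ≈⟨ +-congˡ (at (⋆-distribʳ h _ _) k) ⟩
      f 0 * g 0 * h (suc k) + (((λ j → f 0 * tl g j) ⋆ h) k + (tl f ⋆ g ⋆ h) k)
        ≈⟨ +-congˡ (+-cong (at (⋆-scaleˡ (f 0) (tl g) h) k) (go (tl f) k)) ⟩
      f 0 * g 0 * h (suc k) + (f 0 * (tl g ⋆ h) k + (tl f ⋆ (g ⋆ h)) k)
        ≈⟨ solve 5 (λ a b c d e → a :* b :* c :+ (a :* d :+ e) := a :* (b :* c :+ d) :+ e) refl _ _ _ _ _ ⟩
      f 0 * (g 0 * h (suc k) + (tl g ⋆ h) k) + (tl f ⋆ (g ⋆ h)) k ∎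

  ⋆-identityˡ : ∀ g → oneS ⋆ g ≐ g
  ⋆-identityˡ g = ext go
    where
    go : ∀ k → (oneS ⋆ g) k ≈ g k
    go zero    = *-identityˡ _
    go (suc k) = trans (+-cong (*-identityˡ _) (at (⋆-zeroˡ g) k)) (+-identityʳ _)

  ≐-trans : ∀ {f g h} → f ≐ g → g ≐ h → f ≐ h
  ≐-trans p q = ext λ k → trans (at p k) (at q k)

  seriesRing : CommutativeRing 0ℓ 0ℓ
  seriesRing = record
    { Carrier = Series ; _≈_ = _≐_ ; _+_ = _⊞_ ; _*_ = _⋆_ ; -_ = negS ; 0# = zeroS ; 1# = oneS
    ; isCommutativeRing = record
      { isRing = record
        { +-isAbelianGroup = record
          { isGroup = record
            { isMonoid = record
              { isSemigroup = record
                { isMagma = record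
                  { isEquivalence = record
                    { refl  = ext λ _ → refl
                    ; sym   = λ p → ext λ k → sym (at p k)
                    ; trans = ≐-trans
                    }
                  ; ∙-cong = λ p q → ext λ k → +-cong (at p k) (at q k)
                  }
                ; assoc = λ f g h → ext λ _ → +-assoc _ _ _
                }
              ; identity = (λ f → ext λ _ → +-identityˡ _) , (λ f → ext λ _ → +-identityʳ _)
              }
            ; inverse = (λ f → ext λ _ → -‿inverseˡ _) , (λ f → ext λ _ → -‿inverseʳ _)
            ; ⁻¹-cong = λ p → ext λ k → -‿cong (at p k)
            }
          ; comm = λ f g → ext λ _ → +-comm _ _
          }
        ; *-cong     = ⋆-cong
        ; *-assoc    = ⋆-assoc
        ; *-identity = ⋆-identityˡ , λ g → ≐-trans (⋆-comm g oneS) (⋆-identityˡ g)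
        ; distrib    = (λ h f g → ≐-trans (⋆-comm h (f ⊞ g)) (≐-trans (⋆-distribʳ h f g)
                          (ext λ k → +-cong (at (⋆-comm f h) k) (at (⋆-comm g h) k))))
                     , ⋆-distribʳ
        }
      ; *-comm = ⋆-comm
      }
    }

  ⋆-closed : (P : Carrier → Set) → (∀ {a b} → P a → P b → P (a + b)) →
             (∀ {a b} → P a → P b → P (a * b)) →
             ∀ {f g} → (∀ k → P (f k)) → (∀ k → P (g k)) → ∀ k → P ((f ⋆ g) k)
  ⋆-closed P add mul pf pg zero    = mul (pf 0) (pg 0)
  ⋆-closed P add mul pf pg (suc k) =
    add (mul (pf 0) (pg (suc k))) (⋆-closed P add mul (λ j → pf (suc j)) pg k)

  -- A series with constant term 1 can be cancelled one coefficient at a time, so agreement up to N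
  -- survives.
  ⋆-cancel≤ : ∀ {f a b} N → f 0 ≈ 1# → (∀ k → k ≤ N → (f ⋆ a) k ≈ (f ⋆ b) k) →
              ∀ k → k ≤ N → a k ≈ b k
  ⋆-cancel≤ {f} {a} {b} N f0 eq k k≤N = go k k k≤N ℕ.≤-refl
    where
    open import Algebra.Properties.Ring ring using (+-cancelʳ)
    unit : ∀ c → f 0 * c ≈ c
    unit c = trans (*-congʳ f0) (*-identityˡ c)
    -- The extra bound n makes this a strong induction: all earlier coefficients are available.
    go : ∀ n k → k ≤ N → k ≤ n → a k ≈ b k
    go n zero k≤N k≤n = trans (sym (unit _)) (trans (eq 0 z≤n) (unit _))
    go (suc n) (suc k) k≤N (s≤s k≤n) = trans (sym (unit _)) (trans (+-cancelʳ _ _ _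
      (trans (eq (suc k) k≤N) (+-congˡ (⋆-cong≤ k (λ _ _ → refl)
        (λ j j≤k → sym (go n j (ℕ.≤-trans j≤k (ℕ.≤-trans (ℕ.n≤1+n k) k≤N)) (ℕ.≤-trans j≤k k≤n))))))) (unit _))

  -- As c may be 0, this bounds the degree by m and records the coefficient there. Terms of too
  -- small a degree and cancelling leading terms need no separate notion.
  Top : Series → ℕ → Carrier → Set
  Top f m c = f m ≈ c × (∀ k → m < k → f k ≈ 0#)

  ⋆-constˡ : ∀ f g → (∀ k → f (suc k) ≈ 0#) → ∀ k → (f ⋆ g) k ≈ f 0 * g k
  ⋆-constˡ f g z zero    = refl
  ⋆-constˡ f g z (suc k) =
    trans (+-congˡ (trans (⋆-cong≤ k (λ j _ → z j) (λ _ _ → refl)) (at (⋆-zeroˡ g) k))) (+-identityʳ _)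

  ⋆-top : ∀ {f g m n a b} → Top f m a → Top g n b → Top (f ⋆ g) (m ℕ.+ n) (a * b)
  ⋆-top {f} {g} {zero} {n} (fm , f>) (gn , g>) =
      trans (const n) (*-cong fm gn)
    , λ k n<k → trans (const k) (trans (*-congˡ (g> k n<k)) (zeroʳ _))
    where const = ⋆-constˡ f g (λ k → f> (suc k) (s≤s z≤n))
  ⋆-top {f} {g} {suc m} {n} (fm , f>) (gn , g>) =
      trans (drop (m ℕ.+ n) (s≤s (ℕ.m≤n+m n m))) (proj₁ rec)
    , λ { (suc k) (s≤s m+n<k) → trans (drop k (s≤s (ℕ.≤-trans (ℕ.m≤n+m n m) (ℕ.<⇒≤ m+n<k)))) (proj₂ rec k m+n<k) }
    where
    rec = ⋆-top {tl f} {g} {m} {n} (fm , λ k m<k → f> (suc k) (s≤s m<k)) (gn , g>)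
    drop : ∀ k → n < suc k → (f ⋆ g) (suc k) ≈ (tl f ⋆ g) k
    drop k n<k = trans (+-congʳ (trans (*-congˡ (g> (suc k) n<k)) (zeroʳ _))) (+-identityˡ _)

  ⊞-top : ∀ {f g m a b} → Top f m a → Top g m b → Top (f ⊞ g) m (a + b)
  ⊞-top (fm , f>) (gm , g>) =
    +-cong fm gm , λ k m<k → trans (+-cong (f> k m<k) (g> k m<k)) (+-identityˡ _)

  top-resp : ∀ {f g m a b} → f ≐ g → a ≈ b → Top f m a → Top g m b
  top-resp p q (fm , f>) = trans (sym (at p _)) (trans fm q) , λ k m<k → trans (sym (at p k)) (f> k m<k)

  top-one : Top oneS 0 1#
  top-one = refl , λ { (suc k) _ → refl }

  mono : ℕ → Carrier → Series
  mono zero    c zero    = c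
  mono zero    c (suc j) = 0#
  mono (suc n) c zero    = 0#
  mono (suc n) c (suc j) = mono n c j

  mono-⋆< : ∀ {n} c g k → k < n → (mono n c ⋆ g) k ≈ 0#
  mono-⋆< {suc n} c g zero    _         = zeroˡ _
  mono-⋆< {suc n} c g (suc k) (s≤s k<n) =
    trans (+-cong (zeroˡ _) (mono-⋆< c g k k<n)) (+-identityˡ _)

  mono-⋆+ : ∀ n c g k → (mono n c ⋆ g) (n ℕ.+ k) ≈ c * g k
  mono-⋆+ zero    c g k = ⋆-constˡ (mono 0 c) g (λ _ → refl) k
  mono-⋆+ (suc n) c g k = trans (+-cong (zeroˡ _) (mono-⋆+ n c g k)) (+-identityˡ _)

  mono-≢ : ∀ {n} c k → k ≢ n → mono n c k ≈ 0#
  mono-≢ {zero}  c zero    k≢n = contradiction ≡.refl k≢n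
  mono-≢ {zero}  c (suc k) k≢n = refl
  mono-≢ {suc n} c zero    k≢n = refl
  mono-≢ {suc n} c (suc k) k≢n = mono-≢ c k (λ k≡n → k≢n (≡.cong suc k≡n))

  mono-diag : ∀ n c → mono n c n ≈ c
  mono-diag zero    c = refl
  mono-diag (suc n) c = mono-diag n c

-- q-integers and the q-derivative.

module Bracket (R : CommutativeRing 0ℓ 0ℓ) where
  open CommutativeRing R
  open PowerSeries R
  open SetoidReasoning setoid
  open NatSolver commutativeSemiring using (solve; con; _:=_; _:+_; _:*_)
  open Algebra.Properties.Semiring.Exp semiring public using (_^_)

  -- Horner form of 1 + q + ... + q^(n-1). At q = 1 it is the image of n in the ring, so one
  -- operator covers both derivatives.
  bracket : Carrier → ℕ → Carrier
  bracket q zero    = 0#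
  bracket q (suc n) = 1# + q * bracket q n

  bracket-+ : ∀ q m n → bracket q (m ℕ.+ n) ≈ bracket q m + q ^ m * bracket q n
  bracket-+ q zero    n = sym (trans (+-identityˡ _) (*-identityˡ _))
  bracket-+ q (suc m) n = trans (+-congˡ (*-congˡ (bracket-+ q m n)))
    (solve 4 (λ q a p b → con 1 :+ q :* (a :+ p :* b) := (con 1 :+ q :* a) :+ q :* p :* b) refl _ _ _ _)

  bracket-suc : ∀ q n → bracket q (suc n) ≈ bracket q n + q ^ n
  bracket-suc q zero    = solve 1 (λ q → con 1 :+ q :* con 0 := con 0 :+ con 1) refl q
  bracket-suc q (suc n) = trans (+-congˡ (*-congˡ (bracket-suc q n)))
    (solve 3 (λ q a p → con 1 :+ q :* (a :+ p) := (con 1 :+ q :* a) :+ q :* p) refl _ _ _)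

  -- This is (1 - q)[n] = 1 - qⁿ, with o for 1 - q and no subtraction, so that the semiring solver
  -- applies.
  bracket-geometric : ∀ {q o} → o + q ≈ 1# → ∀ n → q ^ n + o * bracket q n ≈ 1#
  bracket-geometric _ zero = solve 1 (λ o → con 1 :+ o :* con 0 := con 1) refl _
  bracket-geometric {q} {o} o+q (suc n) = begin
    q * q ^ n + o * (1# + q * bracket q n)
      ≈⟨ solve 4 (λ q o p b → q :* p :+ o :* (con 1 :+ q :* b) := o :+ q :* (p :+ o :* b)) refl _ _ _ _ ⟩
    o + q * (q ^ n + o * bracket q n)  ≈⟨ +-congˡ (trans (*-congˡ (bracket-geometric o+q n)) (*-identityʳ q)) ⟩
    o + q                              ≈⟨ o+q ⟩
    1# ∎

  -- θ q is the q-analogue of x·d/dx: it sends f to x(f(qx) − f(x))/(qx − x).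
  -- At q = 1 it is x·d/dx itself, and σ 1 is the identity.
  θ σ : Carrier → Series → Series
  θ q f k = bracket q k * f k
  σ q f k = q ^ k * f k

  σ-⋆ : ∀ q f g → σ q (f ⋆ g) ≐ σ q f ⋆ σ q g
  σ-⋆ q f g = ext (go f)
    where
    go : ∀ f k → σ q (f ⋆ g) k ≈ (σ q f ⋆ σ q g) k
    go f zero    = solve 2 (λ a b → con 1 :* (a :* b) := (con 1 :* a) :* (con 1 :* b)) refl _ _
    go f (suc k) = begin
      q * q ^ k * (f 0 * g (suc k) + (tl f ⋆ g) k)
        ≈⟨ solve 5 (λ q p a b c → q :* p :* (a :* b :+ c) := con 1 :* a :* (q :* p :* b) :+ q :* (p :* c)) refl _ _ _ _ _ ⟩
      1# * f 0 * (q * q ^ k * g (suc k)) + q * (q ^ k * (tl f ⋆ g) k)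
        ≈⟨ +-congˡ (*-congˡ (go (tl f) k)) ⟩
      1# * f 0 * (q * q ^ k * g (suc k)) + q * (σ q (tl f) ⋆ σ q g) k
        ≈⟨ +-congˡ (at (⋆-scaleˡ q (σ q (tl f)) (σ q g)) k) ⟨
      1# * f 0 * (q * q ^ k * g (suc k)) + ((λ j → q * σ q (tl f) j) ⋆ σ q g) k
        ≈⟨ +-congˡ (⋆-cong≤ k (λ _ _ → sym (*-assoc _ _ _)) (λ _ _ → refl)) ⟩
      (σ q f ⋆ σ q g) (suc k) ∎

  -- The q-Leibniz rule; on monomials it is [i + j] = q^j [i] + [j]. Passing to the tail of f lowers
  -- i by one, and [k+1] = [k] + q^k accounts for the difference.
  θ-⋆ : ∀ q f g → θ q (f ⋆ g) ≐ θ q f ⋆ σ q g ⊞ f ⋆ θ q g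
  θ-⋆ q f g = ext (go f)
    where
    go : ∀ f k → θ q (f ⋆ g) k ≈ (θ q f ⋆ σ q g ⊞ f ⋆ θ q g) k
    go f zero    = solve 2 (λ a b → con 0 :* (a :* b) := con 0 :* a :* (con 1 :* b) :+ a :* (con 0 :* b)) refl _ _
    go f (suc k) = begin
      b * (f 0 * g (suc k) + (tl f ⋆ g) k)
        ≈⟨ distribˡ _ _ _ ⟩
      b * (f 0 * g (suc k)) + b * (tl f ⋆ g) k
        ≈⟨ +-congˡ (trans (*-congʳ (bracket-suc q k)) (trans (distribʳ _ _ _) (+-cong (go (tl f) k) (at (σ-⋆ q (tl f) g) k)))) ⟩
      b * (f 0 * g (suc k)) + ((θ q (tl f) ⋆ σ q g) k + (tl f ⋆ θ q g) k + (σ q (tl f) ⋆ σ q g) k)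
        ≈⟨ solve 7 (λ b x y u v w z → b :* (x :* y) :+ (u :+ v :+ w) :=
             con 0 :* x :* z :+ (u :+ w) :+ (x :* (b :* y) :+ v)) refl _ _ _ _ _ _ _ ⟩
      0# * f 0 * σ q g (suc k) + ((θ q (tl f) ⋆ σ q g) k + (σ q (tl f) ⋆ σ q g) k) + (f ⋆ θ q g) (suc k)
        ≈⟨ +-congʳ (+-congˡ (at (⋆-distribʳ (σ q g) (θ q (tl f)) (σ q (tl f))) k)) ⟨
      0# * f 0 * σ q g (suc k) + ((θ q (tl f) ⊞ σ q (tl f)) ⋆ σ q g) k + (f ⋆ θ q g) (suc k)
        ≈⟨ +-congʳ (+-congˡ (⋆-cong≤ k (λ j _ → trans (sym (distribʳ _ _ _)) (*-congʳ (sym (bracket-suc q j)))) (λ _ _ → refl))) ⟩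
      (θ q f ⋆ σ q g ⊞ f ⋆ θ q g) (suc k) ∎
      where b = bracket q (suc k)

  one^ : ∀ n → 1# ^ n ≈ 1#
  one^ zero    = refl
  one^ (suc n) = trans (*-identityˡ _) (one^ n)

  σ-one : ∀ f → σ 1# f ≐ f
  σ-one f = ext λ k → trans (*-congʳ (one^ k)) (*-identityˡ _)

-- Logarithmic derivatives of the q-exponential and of the power product.

module LogDerivative (R : CommutativeRing 0ℓ 0ℓ) where
  open CommutativeRing R
  open PowerSeries R
  open Bracket R
  open SetoidReasoning setoid
  open NatSolver commutativeSemiring using (solve; con; _:=_; _:+_; _:*_)

  nat : ℕ → Carrier
  nat = bracket 1#

  -- As F is its own q-derivative, both sides y satisfy [k+1] y(k+1) = y(k) + F(k).
  qexp-log : ∀ {q o F C} → o + q ≈ 1# →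
    (J : ℕ → Carrier) → (∀ k → J k * bracket q (suc k) ≈ 1#) →
    (∀ k → bracket q (suc k) * F (suc k) ≈ F k) →
    C 0 ≈ 0# → (∀ k → bracket q (suc k) * C (suc k) ≈ o ^ k) →
    θ 1# F ≐ F ⋆ C
  qexp-log {q} {o} {F} {C} o+q J J-inv F-rec C0 C-rec = ext go
    where
    -- In the q-Leibniz rule for F ⋆ C, the shifted `θ q F` is F again and the shifted `θ q C` is
    -- the sequence of powers of o.
    rec : ∀ k → bracket q (suc k) * (F ⋆ C) (suc k) ≈ (F ⋆ C) k + F k
    rec k = begin
      bracket q (suc k) * (F ⋆ C) (suc k)
        ≈⟨ at (θ-⋆ q F C) (suc k) ⟩
      0# * F 0 * σ q C (suc k) + (tl (θ q F) ⋆ σ q C) k + (F ⋆ θ q C) (suc k)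
        ≈⟨ +-cong (+-cong (trans (*-congʳ (zeroˡ _)) (zeroˡ _)) (⋆-cong≤ k (λ j _ → F-rec j) (λ _ _ → refl)))
             (trans (⋆-sucʳ F (θ q C) k) (+-cong (trans (*-congˡ (zeroˡ _)) (zeroʳ _))
               (⋆-cong≤ k (λ _ _ → refl) (λ j _ → C-rec j)))) ⟩
      0# + (F ⋆ σ q C) k + (0# + (F ⋆ (o ^_)) k)
        ≈⟨ +-cong (+-identityˡ _) (+-identityˡ _) ⟩
      (F ⋆ σ q C) k + (F ⋆ (o ^_)) k
        ≈⟨ at (S.distribˡ F (σ q C) (o ^_)) k ⟨
      (F ⋆ (σ q C ⊞ (o ^_))) k
        ≈⟨ ⋆-cong≤ k (λ _ _ → refl) (λ j _ → split j) ⟩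
      (F ⋆ (C ⊞ oneS)) k
        ≈⟨ at (S.distribˡ F C oneS) k ⟩
      (F ⋆ C) k + (F ⋆ oneS) k
        ≈⟨ +-congˡ (at (S.*-identityʳ F) k) ⟩
      (F ⋆ C) k + F k ∎
      where
      module S = CommutativeRing seriesRing
      -- For j ≥ 1 the power o^j equals (1 - q)[j] C j = (1 - q^j) C j. At j = 0 a surplus 1
      -- remains, and it is the source of the summand F k in `rec`.
      split : ∀ j → q ^ j * C j + o ^ j ≈ C j + oneS j
      split zero    = +-congʳ (*-identityˡ _)
      split (suc j) = begin
        q ^ suc j * C (suc j) + o * o ^ j
          ≈⟨ +-congˡ (*-congˡ (C-rec j)) ⟨
        q ^ suc j * C (suc j) + o * (bracket q (suc j) * C (suc j))
          ≈⟨ solve 4 (λ p o b c → p :* c :+ o :* (b :* c) := (p :+ o :* b) :* c) refl _ _ _ _ ⟩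
        (q ^ suc j + o * bracket q (suc j)) * C (suc j)
          ≈⟨ *-congʳ (bracket-geometric o+q (suc j)) ⟩
        1# * C (suc j)
          ≈⟨ solve 1 (λ c → con 1 :* c := c :+ con 0) refl _ ⟩
        C (suc j) + 0# ∎
    cancel : ∀ k {a b} → bracket q (suc k) * a ≈ bracket q (suc k) * b → a ≈ b
    cancel k {a} {b} p = begin
      a                               ≈⟨ trans (*-congʳ (J-inv k)) (*-identityˡ a) ⟨
      J k * bracket q (suc k) * a     ≈⟨ *-assoc _ _ _ ⟩
      J k * (bracket q (suc k) * a)   ≈⟨ *-congˡ p ⟩
      J k * (bracket q (suc k) * b)   ≈⟨ *-assoc _ _ _ ⟨
      J k * bracket q (suc k) * b     ≈⟨ trans (*-congʳ (J-inv k)) (*-identityˡ b) ⟩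
      b ∎
    go : ∀ k → nat k * F k ≈ (F ⋆ C) k
    go zero    = trans (zeroˡ _) (sym (trans (*-congˡ C0) (zeroʳ _)))
    go (suc k) = cancel k (begin
      bracket q (suc k) * (nat (suc k) * F (suc k))
        ≈⟨ solve 3 (λ b n f → b :* ((con 1 :+ con 1 :* n) :* f) := n :* (b :* f) :+ b :* f) refl _ _ _ ⟩
      nat k * (bracket q (suc k) * F (suc k)) + bracket q (suc k) * F (suc k)
        ≈⟨ +-cong (*-congˡ (F-rec k)) (F-rec k) ⟩
      nat k * F k + F k
        ≈⟨ +-congʳ (go k) ⟩
      (F ⋆ C) k + F k
        ≈⟨ rec k ⟨
      bracket q (suc k) * (F ⋆ C) (suc k) ∎)

  module PowerProduct (e : ℕ → Carrier) where
    φ : ℕ → Series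
    φ n = oneS ⊞ mono n (e n)

    partialProduct : ℕ → Series
    partialProduct zero    = oneS
    partialProduct (suc n) = partialProduct n ⋆ φ (suc n)

    -- The coefficient of x^(mn) in n eₙ xⁿ/(1 + eₙ xⁿ).
    γ : ℕ → ℕ → Carrier
    γ n zero    = 0#
    γ n (suc m) = nat n * e n * (- e n) ^ m

    -- The full series n eₙ xⁿ - n eₙ² x²ⁿ + ..., supported on multiples of n; at a fixed index, the
    -- sum over n is therefore a sum over divisors.
    factorLog : ℕ → Series
    factorLog n k with n ∣ₙ? k
    ... | yes (divides m _) = γ n m
    ... | no _              = 0#

    factorLog-∤ : ∀ {n k} → n ∤ₙ k → factorLog n k ≈ 0#
    factorLog-∤ {n} {k} n∤k with n ∣ₙ? k
    ... | yes n∣k = contradiction n∣k n∤k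
    ... | no _    = refl

    factorLog-* : ∀ n m → factorLog (suc n) (m ℕ.* suc n) ≈ γ (suc n) m
    factorLog-* n m with suc n ∣ₙ? m ℕ.* suc n
    ... | yes (divides m′ eq) = reflexive (≡.cong (γ (suc n)) (ℕ.*-cancelʳ-≡ m′ m (suc n) (≡.sym eq)))
    ... | no ∤               = contradiction (ℕ.n∣m*n m) ∤

    -- The geometric series telescopes against 1 + eₙ xⁿ: above degree n each coefficient of the
    -- product is a sum of two opposite values of `γ`, or zero from the start, and only n eₙ xⁿ
    -- survives.
    θ-φ : ∀ n → θ 1# (φ (suc n)) ≐ φ (suc n) ⋆ factorLog (suc n)
    θ-φ n = ext λ k → trans (go k) (sym (trans (at (⋆-distribʳ ℓ oneS μ) k) (+-congʳ (at (⋆-identityˡ ℓ) k))))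
      where
      N = suc n
      ℓ = factorLog N
      μ = mono N (e N)
      γ-rec : ∀ m → γ N (suc (suc m)) + e N * γ N (suc m) ≈ 0#
      γ-rec m = begin
        nat N * e N * (- e N * (- e N) ^ m) + e N * (nat N * e N * (- e N) ^ m)
          ≈⟨ solve 4 (λ k e s p → k :* e :* (s :* p) :+ e :* (k :* e :* p) := k :* e :* p :* (s :+ e)) refl _ _ _ _ ⟩
        nat N * e N * (- e N) ^ m * (- e N + e N)
          ≈⟨ trans (*-congˡ (-‿inverseˡ _)) (zeroʳ _) ⟩
        0# ∎
      -- The cases are j = 0, which gives the surviving coefficient, j a positive multiple of N,
      -- which cancels by `γ-rec`, and j not a multiple of N.
      high : ∀ j → θ 1# (φ N) (N ℕ.+ j) ≈ ℓ (N ℕ.+ j) + e N * ℓ j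
      high j with N ∣ₙ? j
      high j | yes (divides zero ≡.refl) = begin
        nat (N ℕ.+ 0) * (0# + μ (N ℕ.+ 0))
          ≡⟨ ≡.cong (λ k → nat k * (0# + μ k)) (ℕ.+-identityʳ N) ⟩
        nat N * (0# + μ N)
          ≈⟨ *-congˡ (+-congˡ (mono-diag N (e N))) ⟩
        nat N * (0# + e N)
          ≈⟨ solve 2 (λ k e → k :* (con 0 :+ e) := k :* e :* con 1 :+ e :* con 0) refl _ _ ⟩
        γ N 1 + e N * 0#
          ≈⟨ +-congʳ (factorLog-* n 1) ⟨
        ℓ (N ℕ.+ 0) + e N * 0# ∎
      high j | yes (divides (suc m) ≡.refl) = begin
        nat (N ℕ.+ j) * (0# + μ (N ℕ.+ j))
          ≈⟨ *-congˡ (trans (+-identityˡ _) (mono-≢ (e N) (N ℕ.+ j) (ℕ.m+1+n≢m N))) ⟩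
        nat (N ℕ.+ j) * 0#
          ≈⟨ trans (zeroʳ _) (sym (γ-rec m)) ⟩
        γ N (suc (suc m)) + e N * γ N (suc m)
          ≈⟨ +-congʳ (factorLog-* n (suc (suc m))) ⟨
        ℓ (N ℕ.+ j) + e N * γ N (suc m) ∎
      high j | no N∤j = begin
        nat (N ℕ.+ j) * (0# + μ (N ℕ.+ j))
          ≈⟨ *-congˡ (trans (+-identityˡ _) (mono-≢ (e N) (N ℕ.+ j) (λ eq → N∤j (≡.subst (N ∣ₙ_)
               (≡.sym (ℕ.+-cancelˡ-≡ N j 0 (≡.trans eq (≡.sym (ℕ.+-identityʳ N))))) (N ℕ.∣0))))) ⟩
        nat (N ℕ.+ j) * 0#
          ≈⟨ solve 2 (λ a b → a :* con 0 := con 0 :+ b :* con 0) refl _ _ ⟩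
        0# + e N * 0#
          ≈⟨ +-congʳ (factorLog-∤ (λ N∣N+j → N∤j (ℕ.∣m+n∣m⇒∣n N∣N+j ℕ.∣-refl))) ⟨
        ℓ (N ℕ.+ j) + e N * 0# ∎
      low : ∀ k → k < N → θ 1# (φ N) k ≈ ℓ k
      low zero    _   = trans (zeroˡ _) (sym (factorLog-* n 0))
      low (suc k) k<N = trans (trans (*-congˡ (trans (+-identityˡ _) (mono-≢ (e N) (suc k) (ℕ.<⇒≢ k<N)))) (zeroʳ _))
        (sym (factorLog-∤ (λ N∣k → ℕ.<⇒≱ k<N (ℕ.∣⇒≤ N∣k))))
      go : ∀ k → θ 1# (φ N) k ≈ ℓ k + (μ ⋆ ℓ) k
      go k with k ℕ.<? N
      ... | yes k<N = trans (low k k<N) (sym (trans (+-congˡ (mono-⋆< (e N) ℓ k k<N)) (+-identityʳ _)))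
      ... | no  k≮N = ≡.subst (λ k → θ 1# (φ N) k ≈ ℓ k + (μ ⋆ ℓ) k) (ℕ.m+[n∸m]≡n (ℕ.≮⇒≥ k≮N))
        (trans (high (k ℕ.∸ N)) (+-congˡ (sym (mono-⋆+ N (e N) ℓ (k ℕ.∸ N)))))

    logSum : ℕ → Series
    logSum zero    = zeroS
    logSum (suc n) = logSum n ⊞ factorLog (suc n)

    -- At q = 1 the twist `σ` is trivial, so logarithmic derivatives of factors add up.
    θ-partialProduct : ∀ n → θ 1# (partialProduct n) ≐ partialProduct n ⋆ logSum n
    θ-partialProduct zero = ext λ k → trans (θ-one k) (sym (at (CommutativeRing.zeroʳ seriesRing oneS) k))
      where
      θ-one : ∀ k → θ 1# oneS k ≈ 0#
      θ-one zero    = zeroˡ _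
      θ-one (suc k) = zeroʳ _
    θ-partialProduct (suc n) = S.trans (θ-⋆ 1# P (φ N))
        (S.trans (S.+-cong (S.*-cong (θ-partialProduct n) (σ-one (φ N))) (S.*-congˡ (θ-φ n)))
          (S-solve 4 (λ p l f m → (p ⊗ l) ⊗ f ⊕ p ⊗ (f ⊗ m) ⊜ (p ⊗ f) ⊗ (l ⊕ m)) S.refl P (logSum n) (φ N) (factorLog N)))
      where
      module S = CommutativeRing seriesRing
      open NatSolver S.commutativeSemiring using () renaming (solve to S-solve; _:=_ to _⊜_; _:+_ to _⊕_; _:*_ to _⊗_)
      P = partialProduct n
      N = suc n

    module _ {F : Series} (F0 : F 0 ≈ 1#) (expansion : ∀ n → partialProduct (suc n) (suc n) ≈ F (suc n)) where

      -- The factor with index n+1 is 1 + O(x^(n+1)), so coefficients up to n are final once n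
      -- factors are present.
      partialProduct-coeff : ∀ n k → k ≤ n → partialProduct n k ≈ F k
      partialProduct-coeff zero    zero    _ = sym F0
      partialProduct-coeff (suc n) k k≤1+n with ℕ.m≤n⇒m<n∨m≡n k≤1+n
      ... | inj₂ ≡.refl = expansion n
      ... | inj₁ (s≤s k≤n) = begin
        (P ⋆ (oneS ⊞ μ)) k    ≈⟨ at (CommutativeRing.distribˡ seriesRing P oneS μ) k ⟩
        (P ⋆ oneS) k + (P ⋆ μ) k
          ≈⟨ +-cong (at (CommutativeRing.*-identityʳ seriesRing P) k) (trans (at (⋆-comm P μ) k) (mono-⋆< (e (suc n)) P k (s≤s k≤n))) ⟩
        P k + 0#              ≈⟨ trans (+-identityʳ _) (partialProduct-coeff n k k≤n) ⟩
        F k ∎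
        where
        P = partialProduct n
        μ = mono (suc n) (e (suc n))

      -- Up to degree n, both `logSum n` and C solve F·y = x F′, and F has constant term 1.
      logSum-coeff : ∀ {C} → θ 1# F ≐ F ⋆ C → ∀ n → logSum n n ≈ C n
      logSum-coeff {C} log n = ⋆-cancel≤ n F0 (λ k k≤n → begin
        (F ⋆ logSum n) k
          ≈⟨ ⋆-cong≤ k (λ j j≤k → sym (partialProduct-coeff n j (ℕ.≤-trans j≤k k≤n))) (λ _ _ → refl) ⟩
        (partialProduct n ⋆ logSum n) k
          ≈⟨ at (θ-partialProduct n) k ⟨
        nat k * partialProduct n k
          ≈⟨ *-congˡ (partialProduct-coeff n k k≤n) ⟩
        nat k * F k
          ≈⟨ at log k ⟩
        (F ⋆ C) k ∎) n ℕ.≤-refl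

      -- The last factor contributes e (n+1) times the constant term 1. This gives e (n+1) from F
      -- and earlier values without dividing by n+1, which is what integrality needs.
      expansion-rec : ∀ n → partialProduct n (suc n) + e (suc n) ≈ F (suc n)
      expansion-rec n = begin
        P (suc n) + e (suc n)
          ≈⟨ +-congˡ (trans (*-comm _ _) (trans (*-congˡ (partialProduct-coeff n 0 z≤n)) (trans (*-congˡ F0) (*-identityʳ _)))) ⟨
        P (suc n) + P 0 * e (suc n)
          ≈⟨ +-congˡ (trans (*-comm _ _) (sym (trans (at (⋆-comm P μ) (suc n))
               (trans (reflexive (≡.cong (μ ⋆ P) (≡.sym (ℕ.+-identityʳ (suc n))))) (mono-⋆+ (suc n) (e (suc n)) P 0))))) ⟩
        P (suc n) + (P ⋆ μ) (suc n)
          ≈⟨ +-congʳ (at (CommutativeRing.*-identityʳ seriesRing P) (suc n)) ⟨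
        (P ⋆ oneS) (suc n) + (P ⋆ μ) (suc n)
          ≈⟨ at (CommutativeRing.distribˡ seriesRing P oneS μ) (suc n) ⟨
        partialProduct (suc n) (suc n)
          ≈⟨ expansion n ⟩
        F (suc n) ∎
        where
        P = partialProduct n
        μ = mono (suc n) (e (suc n))

-- Coefficient lists as a commutative ring.

module ListPoly (R : CommutativeRing 0ℓ 0ℓ) where
  open CommutativeRing R
  open PowerSeries R
  open PolyOps 0# _+_ _*_

  ⟦_⟧ : List Carrier → Series
  ⟦ p ⟧ k = coeff k p

  infix 4 _≋_
  record _≋_ (p q : List Carrier) : Set where
    constructor coeffs
    field coeffs-≐ : ⟦ p ⟧ ≐ ⟦ q ⟧
  open _≋_ public

  ⟦⟧-addP : ∀ p q → ⟦ addP p q ⟧ ≐ ⟦ p ⟧ ⊞ ⟦ q ⟧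
  ⟦⟧-addP p q = ext (go p q)
    where
    go : ∀ p q k → coeff k (addP p q) ≈ coeff k p + coeff k q
    go []      q       k       = sym (+-identityˡ _)
    go (a ∷ p) []      k       = sym (+-identityʳ _)
    go (a ∷ p) (b ∷ q) zero    = refl
    go (a ∷ p) (b ∷ q) (suc k) = go p q k

  coeff-scaleP : ∀ a p k → coeff k (scaleP a p) ≈ a * coeff k p
  coeff-scaleP a []      k       = sym (zeroʳ a)
  coeff-scaleP a (b ∷ p) zero    = refl
  coeff-scaleP a (b ∷ p) (suc k) = coeff-scaleP a p k

  ⟦⟧-mulP : ∀ p q → ⟦ mulP p q ⟧ ≐ ⟦ p ⟧ ⋆ ⟦ q ⟧
  ⟦⟧-mulP p q = ext (go p)
    where
    go : ∀ p k → coeff k (mulP p q) ≈ (⟦ p ⟧ ⋆ ⟦ q ⟧) k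
    go []      k       = sym (at (⋆-zeroˡ ⟦ q ⟧) k)
    go (a ∷ p) zero    = trans (at (⟦⟧-addP (scaleP a q) _) 0)
      (trans (+-identityʳ _) (coeff-scaleP a q 0))
    go (a ∷ p) (suc k) = trans (at (⟦⟧-addP (scaleP a q) _) (suc k))
      (+-cong (coeff-scaleP a q (suc k)) (go p k))

  negP : List Carrier → List Carrier
  negP = map (λ a → - a)

  ⟦⟧-negP : ∀ p → ⟦ negP p ⟧ ≐ negS ⟦ p ⟧
  ⟦⟧-negP p = ext (go p)
    where
    open Algebra.Properties.Ring ring using (-0#≈0#)
    go : ∀ p k → coeff k (negP p) ≈ - coeff k p
    go []      k       = sym -0#≈0#
    go (a ∷ p) zero    = refl
    go (a ∷ p) (suc k) = go p k

  ⟦1⟧ : ⟦ 1# ∷ [] ⟧ ≐ oneS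
  ⟦1⟧ = ext λ { zero → refl ; (suc k) → refl }

  private module S = CommutativeRing seriesRing

  isRingMonomorphism : IsRingMonomorphism
    (record { Carrier = List Carrier ; _≈_ = _≋_ ; _+_ = addP ; _*_ = mulP ; -_ = negP ; 0# = [] ; 1# = 1# ∷ [] })
    S.rawRing ⟦_⟧
  isRingMonomorphism = record
    { isRingHomomorphism = record
      { isSemiringHomomorphism = record
        { isNearSemiringHomomorphism = record
          { +-isMonoidHomomorphism = record
            { isMagmaHomomorphism = record
              { isRelHomomorphism = record { cong = coeffs-≐ }
              ; homo = ⟦⟧-addP
              }
            ; ε-homo = S.refl
            }
          ; *-homo = ⟦⟧-mulP
          }
        ; 1#-homo = ⟦1⟧
        }
      ; -‿homo = ⟦⟧-negP
      }
    ; injective = coeffs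
    }

  -- Lists are compared by coefficients because trailing zeros are allowed. Then `⟦_⟧` is injective
  -- by definition and all ring laws pull back from series.
  polyRing : CommutativeRing 0ℓ 0ℓ
  polyRing = record
    { isCommutativeRing = RingMonomorphism.isCommutativeRing isRingMonomorphism S.isCommutativeRing }

-- Fractions with cancellable denominators.

module Fractions (R : CommutativeRing 0ℓ 0ℓ) where
  open CommutativeRing R
  open SetoidReasoning setoid
  open NatSolver commutativeSemiring using (solve; con; _:=_; _:+_; _:*_)

  -- Being cancellable is exactly what transitivity of cross-multiplication uses: the middle
  -- denominator has to be cancelled.
  Regular : Carrier → Set
  Regular b = ∀ {x y} → x * b ≈ y * b → x ≈ y

  regular-* : ∀ {a b} → Regular a → Regular b → Regular (a * b)
  regular-* ra rb p = ra (rb (trans (*-assoc _ _ _) (trans p (sym (*-assoc _ _ _)))))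

  regular-1 : Regular 1#
  regular-1 p = trans (sym (*-identityʳ _)) (trans p (*-identityʳ _))

  record Fraction : Set where
    constructor fraction
    field
      numer denom : Carrier
      regular     : Regular denom
  open Fraction public

  infix 4 _≃_
  record _≃_ (x y : Fraction) : Set where
    constructor cross
    field cross-≈ : numer x * denom y ≈ numer y * denom x
  open _≃_ public

  ι : Carrier → Fraction
  ι a = fraction a 1# regular-1

  _⊕_ _⊗_ : Fraction → Fraction → Fraction
  fraction a b r ⊕ fraction c d s = fraction (a * d + c * b) (b * d) (regular-* r s)
  fraction a b r ⊗ fraction c d s = fraction (a * c) (b * d) (regular-* r s)

  ⊖_ : Fraction → Fraction
  ⊖ fraction a b r = fraction (- a) b r

  ≃-trans : ∀ {x y z} → x ≃ y → y ≃ z → x ≃ z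
  ≃-trans {fraction a b _} {fraction c d s} {fraction e f _} (cross p) (cross q) = cross (s (begin
    a * f * d    ≈⟨ solve 3 (λ a f d → a :* f :* d := a :* d :* f) refl _ _ _ ⟩
    a * d * f    ≈⟨ *-congʳ p ⟩
    c * b * f    ≈⟨ solve 3 (λ c b f → c :* b :* f := c :* f :* b) refl _ _ _ ⟩
    c * f * b    ≈⟨ *-congʳ q ⟩
    e * d * b    ≈⟨ solve 3 (λ e d b → e :* d :* b := e :* b :* d) refl _ _ _ ⟩
    e * b * d    ∎))

  fractionRing : CommutativeRing 0ℓ 0ℓ
  fractionRing = record
    { Carrier = Fraction ; _≈_ = _≃_ ; _+_ = _⊕_ ; _*_ = _⊗_ ; -_ = ⊖_ ; 0# = ι 0# ; 1# = ι 1#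
    ; isCommutativeRing = record
      { isRing = record
        { +-isAbelianGroup = record
          { isGroup = record
            { isMonoid = record
              { isSemigroup = record
                { isMagma = record
                  { isEquivalence = record
                    { refl = cross refl ; sym = λ (cross p) → cross (sym p) ; trans = ≃-trans }
                  ; ∙-cong = ⊕-cong
                  }
                ; assoc = λ _ _ _ → cross (solve 6 (λ a b c d e f →
                    ((a :* d :+ c :* b) :* f :+ e :* (b :* d)) :* (b :* (d :* f)) :=
                    (a :* (d :* f) :+ (c :* f :+ e :* d) :* b) :* ((b :* d) :* f)) refl _ _ _ _ _ _)
                }
              ; identity = (λ _ → cross (⊕-identityˡ _ _)) , (λ _ → cross (⊕-identityʳ _ _))
              }
            ; inverse = (λ _ → cross (⊕-inverse _ _ (-‿inverseˡ _))) , (λ _ → cross (⊕-inverse _ _ (-‿inverseʳ _)))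
            ; ⁻¹-cong = ⊖-cong
            }
          ; comm = λ _ _ → cross (solve 4 (λ a b c d → (a :* d :+ c :* b) :* (d :* b) := (c :* b :+ a :* d) :* (b :* d)) refl _ _ _ _)
          }
        ; *-cong = ⊗-cong
        ; *-assoc = λ _ _ _ → cross (solve 6 (λ a b c d e f →
            a :* c :* e :* (b :* (d :* f)) := a :* (c :* e) :* (b :* d :* f)) refl _ _ _ _ _ _)
        ; *-identity = (λ _ → cross (solve 2 (λ a b → con 1 :* a :* b := a :* (con 1 :* b)) refl _ _))
                     , (λ _ → cross (solve 2 (λ a b → a :* con 1 :* b := a :* (b :* con 1)) refl _ _))
        ; distrib = (λ _ _ _ → cross (solve 6 (λ a b c d e f →
            a :* (c :* f :+ e :* d) :* ((b :* d) :* (b :* f)) :=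
            (a :* c :* (b :* f) :+ a :* e :* (b :* d)) :* (b :* (d :* f))) refl _ _ _ _ _ _))
                  , (λ _ _ _ → cross (solve 6 (λ a b c d e f →
            (c :* f :+ e :* d) :* a :* ((d :* b) :* (f :* b)) :=
            (c :* a :* (f :* b) :+ e :* a :* (d :* b)) :* (d :* f :* b)) refl _ _ _ _ _ _))
        }
      ; *-comm = λ _ _ → cross (solve 4 (λ a b c d → a :* c :* (d :* b) := c :* a :* (b :* d)) refl _ _ _ _)
      }
    }
    where
    open Algebra.Properties.Ring ring using (-‿distribˡ-*)
    ⊕-cong : ∀ {x y u v} → x ≃ y → u ≃ v → x ⊕ u ≃ y ⊕ v
    ⊕-cong {fraction a b _} {fraction a′ b′ _} {fraction c d _} {fraction c′ d′ _} (cross p) (cross q) = cross (begin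
      (a * d + c * b) * (b′ * d′)
        ≈⟨ solve 6 (λ a b c d b′ d′ → (a :* d :+ c :* b) :* (b′ :* d′) :=
             a :* b′ :* (d :* d′) :+ c :* d′ :* (b :* b′)) refl _ _ _ _ _ _ ⟩
      a * b′ * (d * d′) + c * d′ * (b * b′)
        ≈⟨ +-cong (*-congʳ p) (*-congʳ q) ⟩
      a′ * b * (d * d′) + c′ * d * (b * b′)
        ≈⟨ solve 6 (λ a′ b c′ d b′ d′ → a′ :* b :* (d :* d′) :+ c′ :* d :* (b :* b′) :=
             (a′ :* d′ :+ c′ :* b′) :* (b :* d)) refl _ _ _ _ _ _ ⟩
      (a′ * d′ + c′ * b′) * (b * d) ∎)
    ⊗-cong : ∀ {x y u v} → x ≃ y → u ≃ v → x ⊗ u ≃ y ⊗ v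
    ⊗-cong {fraction a b _} {fraction a′ b′ _} {fraction c d _} {fraction c′ d′ _} (cross p) (cross q) = cross (begin
      a * c * (b′ * d′)    ≈⟨ solve 4 (λ a c b d → a :* c :* (b :* d) := a :* b :* (c :* d)) refl _ _ _ _ ⟩
      a * b′ * (c * d′)    ≈⟨ *-cong p q ⟩
      a′ * b * (c′ * d)    ≈⟨ solve 4 (λ a c b d → a :* c :* (b :* d) := a :* b :* (c :* d)) refl _ _ _ _ ⟩
      a′ * c′ * (b * d)    ∎)
    ⊖-cong : ∀ {x y} → x ≃ y → ⊖ x ≃ ⊖ y
    ⊖-cong (cross p) = cross (trans (sym (-‿distribˡ-* _ _)) (trans (-‿cong p) (-‿distribˡ-* _ _)))
    ⊕-identityˡ : ∀ a b → (0# * b + a * 1#) * b ≈ a * (1# * b)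
    ⊕-identityˡ = solve 2 (λ a b → (con 0 :* b :+ a :* con 1) :* b := a :* (con 1 :* b)) refl
    ⊕-identityʳ : ∀ a b → (a * 1# + 0# * b) * b ≈ a * (b * 1#)
    ⊕-identityʳ = solve 2 (λ a b → (a :* con 1 :+ con 0 :* b) :* b := a :* (b :* con 1)) refl
    ⊕-inverse : ∀ {a a′} b c → a + a′ ≈ 0# → (a * b + a′ * b) * 1# ≈ 0# * c
    ⊕-inverse b c p = trans (*-identityʳ _) (trans (sym (distribʳ _ _ _)) (trans (*-congʳ p) (trans (zeroˡ _) (sym (zeroˡ _)))))

  ι-isRingMonomorphism : IsRingMonomorphism rawRing (CommutativeRing.rawRing fractionRing) ι
  ι-isRingMonomorphism = record
    { isRingHomomorphism = record
      { isSemiringHomomorphism = record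
        { isNearSemiringHomomorphism = record
          { +-isMonoidHomomorphism = record
            { isMagmaHomomorphism = record
              { isRelHomomorphism = record { cong = λ p → cross (*-congʳ p) }
              ; homo = λ _ _ → cross (solve 2 (λ a b → (a :+ b) :* (con 1 :* con 1) := (a :* con 1 :+ b :* con 1) :* con 1) refl _ _)
              }
            ; ε-homo = cross refl
            }
          ; *-homo = λ _ _ → cross (*-congˡ (*-identityʳ 1#))
          }
        ; 1#-homo = cross refl
        }
      ; -‿homo = λ _ → cross refl
      }
    ; injective = λ p → regular-1 (cross-≈ p)
    }

-- Divisibility of q-integers and the product of their gcds.

module Divisors (R : CommutativeRing 0ℓ 0ℓ) where
  open CommutativeRing R
  open Bracket R
  open SetoidReasoning setoid
  open NatSolver commutativeSemiring using (solve; con; _:=_; _:+_; _:*_)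
  open Algebra.Properties.Monoid.Divisibility *-monoid
  open Algebra.Properties.CommutativeSemigroup.Divisibility *-commutativeSemigroup using (∙-cong-∣)

  ∣-cancel-+ˡ : ∀ {c a b} → c ∣ a → c ∣ a + b → c ∣ b
  ∣-cancel-+ˡ {c} {a} {b} (u , uc) (v , vc) = v + - u , (begin
    (v + - u) * c      ≈⟨ distribʳ _ _ _ ⟩
    v * c + - u * c    ≈⟨ +-cong vc (trans (sym (-‿distribˡ-* u c)) (-‿cong uc)) ⟩
    a + b + - a        ≈⟨ trans (+-congʳ (+-comm a b)) (+-assoc b a (- a)) ⟩
    b + (a + - a)      ≈⟨ trans (+-congˡ (-‿inverseʳ a)) (+-identityʳ b) ⟩
    b ∎)
    where open Algebra.Properties.Ring ring using (-‿distribˡ-*)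

  bracket-∣ : ∀ q {m n} → m ∣ₙ n → bracket q m ∣ bracket q n
  bracket-∣ q {m} (divides k ≡.refl) = go k
    where
    go : ∀ k → bracket q m ∣ bracket q (k ℕ.* m)
    go zero    = 0# , zeroˡ _
    go (suc k) with go k
    ... | u , eq = 1# + q ^ m * u , (begin
      (1# + q ^ m * u) * bracket q m
        ≈⟨ solve 3 (λ p u b → (con 1 :+ p :* u) :* b := b :+ p :* (u :* b)) refl _ _ _ ⟩
      bracket q m + q ^ m * (u * bracket q m)
        ≈⟨ +-congˡ (*-congˡ eq) ⟩
      bracket q m + q ^ m * bracket q (k ℕ.* m)
        ≈⟨ bracket-+ q m (k ℕ.* m) ⟨
      bracket q (m ℕ.+ k ℕ.* m) ∎)

  -- [n+1] = 1 + q[n] is coprime to q.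
  ∣-cancel-q^ : ∀ {q c} n → c ∣ bracket q (suc n) → ∀ k {y} → c ∣ q ^ k * y → c ∣ y
  ∣-cancel-q^ n c∣ zero {y} c∣y = ∣ʳ-respʳ-≈ (*-identityˡ y) c∣y
  ∣-cancel-q^ {q} {c} n c∣ (suc k) {y} c∣y = ∣-cancel-q^ n c∣ k
    (∣-cancel-+ˡ (x∣ʳy⇒x∣ʳzy (bracket q n) c∣y)
      (∣ʳ-respʳ-≈ (solve 4 (λ q b p y → p :* y :* (con 1 :+ q :* b) := b :* (q :* p :* y) :+ p :* y) refl _ _ _ _)
        (x∣ʳy⇒x∣ʳzy (q ^ k * y) c∣)))

  -- A Bézout relation d + a = b between multiples of n and m+1 becomes [b] = [a] + q^a [d]; the
  -- power of q can be removed because c divides [m+1]. Thus [gcd] has the universal property of a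
  -- gcd without any polynomial division.
  bracket-gcd : ∀ {q c} m n → c ∣ bracket q (suc m) → c ∣ bracket q n → c ∣ bracket q (gcd (suc m) n)
  bracket-gcd {q} {c} m n c∣m c∣n = go (Bézout.identity (gcd-GCD (suc m) n))
    where
    combine : ∀ d a {b} → d ℕ.+ a ≡ b → c ∣ bracket q a → c ∣ bracket q b → c ∣ bracket q d
    combine d a ≡.refl c∣a c∣b = ∣-cancel-q^ m c∣m a (∣-cancel-+ˡ c∣a (∣ʳ-respʳ-≈
      (trans (reflexive (≡.cong (bracket q) (ℕ.+-comm d a))) (bracket-+ q a d)) c∣b))
    multiple : ∀ k j → c ∣ bracket q j → c ∣ bracket q (k ℕ.* j)
    multiple k j c∣j = ∣ʳ-trans c∣j (bracket-∣ q (ℕ.n∣m*n k))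
    go : Bézout.Identity (gcd (suc m) n) (suc m) n → c ∣ bracket q (gcd (suc m) n)
    go (Bézout.+- x y eq) = combine _ (y ℕ.* n) eq (multiple y n c∣n) (multiple x (suc m) c∣m)
    go (Bézout.-+ x y eq) = combine _ (x ℕ.* suc m) eq (multiple x (suc m) c∣m) (multiple y n c∣n)

  prod : (ℕ → Carrier) → ℕ → Carrier
  prod f zero    = 1#
  prod f (suc n) = prod f n * f (suc n)

  prod-cong : ∀ {f g} n → (∀ j → 1 ≤ j → j ≤ n → f j ≈ g j) → prod f n ≈ prod g n
  prod-cong zero    p = refl
  prod-cong (suc n) p = *-cong (prod-cong n (λ j 1≤j j≤n → p j 1≤j (ℕ.m≤n⇒m≤1+n j≤n))) (p (suc n) (s≤s z≤n) ℕ.≤-refl)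

  prod-∣ : ∀ {f g} n → (∀ j → f j ∣ g j) → prod f n ∣ prod g n
  prod-∣ zero    p = ∣ʳ-refl
  prod-∣ (suc n) p = ∙-cong-∣ (prod-∣ n p) (p (suc n))

  prod-+ : ∀ f m n → prod f (m ℕ.+ n) ≈ prod f m * prod (λ j → f (m ℕ.+ j)) n
  prod-+ f m zero    = trans (reflexive (≡.cong (prod f) (ℕ.+-identityʳ m))) (sym (*-identityʳ _))
  prod-+ f m (suc n) = begin
    prod f (m ℕ.+ suc n)
      ≡⟨ ≡.cong (prod f) (ℕ.+-suc m n) ⟩
    prod f (m ℕ.+ n) * f (suc (m ℕ.+ n))
      ≈⟨ *-cong (prod-+ f m n) (reflexive (≡.cong f (≡.sym (ℕ.+-suc m n)))) ⟩
    prod f m * prod (λ j → f (m ℕ.+ j)) n * f (m ℕ.+ suc n)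
      ≈⟨ *-assoc _ _ _ ⟩
    prod f m * (prod (λ j → f (m ℕ.+ j)) n * f (m ℕ.+ suc n)) ∎

  prod-periodic : ∀ f d → (∀ j → f (d ℕ.+ j) ≈ f j) → ∀ m → prod f (m ℕ.* d) ≈ prod f d ^ m
  prod-periodic f d per zero    = refl
  prod-periodic f d per (suc m) = trans (prod-+ f d (m ℕ.* d))
    (*-congˡ (trans (prod-cong (m ℕ.* d) (λ j _ _ → per j)) (prod-periodic f d per m)))

  gcdProduct : Carrier → ℕ → Carrier
  gcdProduct q n = prod (λ j → bracket q (gcd j n)) n

  -- Since j ↦ gcd(j, d) has period d, the power is the product of [gcd(j, d)] over j ≤ md, and each
  -- factor divides the corresponding [gcd(j, md)].
  gcdProduct-^∣ : ∀ q m d → gcdProduct q d ^ m ∣ gcdProduct q (m ℕ.* d)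
  gcdProduct-^∣ q m d = ∣ʳ-respˡ-≈ (prod-periodic _ d (λ j → reflexive (≡.cong (bracket q) (periodic j))) m)
    (prod-∣ (m ℕ.* d) (λ j → bracket-∣ q
      (gcd-greatest (gcd[m,n]∣m j d) (ℕ.∣-trans (gcd[m,n]∣n j d) (ℕ.n∣m*n m)))))
    where
    periodic : ∀ j → gcd (d ℕ.+ j) d ≡ gcd j d
    periodic j = ℕ.∣-antisym
      (gcd-greatest (ℕ.∣m+n∣m⇒∣n (gcd[m,n]∣m (d ℕ.+ j) d) (gcd[m,n]∣n (d ℕ.+ j) d)) (gcd[m,n]∣n (d ℕ.+ j) d))
      (gcd-greatest (ℕ.∣m∣n⇒∣m+n (gcd[m,n]∣n j d) (gcd[m,n]∣m j d)) (gcd[m,n]∣n j d))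

-- Subrings, and exact division by a monic polynomial within them.

record IsSubring (R : CommutativeRing 0ℓ 0ℓ) (P : CommutativeRing.Carrier R → Set) : Set where
  open CommutativeRing R
  field
    resp  : ∀ {a b} → a ≈ b → P a → P b
    has-0 : P 0#
    has-1 : P 1#
    add   : ∀ {a b} → P a → P b → P (a + b)
    mul   : ∀ {a b} → P a → P b → P (a * b)
    neg   : ∀ {a} → P a → P (- a)

module SubringSeries (R : CommutativeRing 0ℓ 0ℓ) {P : CommutativeRing.Carrier R → Set} (P-subring : IsSubring R P) where
  open CommutativeRing R
  open PowerSeries R
  open IsSubring P-subring
  open SetoidReasoning setoid

  Over : Series → Set
  Over f = ∀ k → P (f k)

  over-⋆ : ∀ {f g} → Over f → Over g → Over (f ⋆ g)
  over-⋆ = ⋆-closed P add mul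

  over-one : Over oneS
  over-one zero    = has-1
  over-one (suc k) = has-0

  over-mono : ∀ n {c} → P c → Over (mono n c)
  over-mono zero    pc zero    = pc
  over-mono zero    pc (suc k) = has-0
  over-mono (suc n) pc zero    = has-0
  over-mono (suc n) pc (suc k) = over-mono n pc k

  -- Division by a monic polynomial: peel off the leading coefficient of the quotient.
  over-quotient : ∀ {d m} → Top d m 1# → Over d → ∀ n r → (∀ k → n ≤ k → r k ≈ 0#) → Over (d ⋆ r) → Over r
  over-quotient td pd zero    r r≥ p k = resp (sym (r≥ k z≤n)) has-0
  over-quotient {d} {m} td pd (suc n) r r≥ p k = resp restore (add (rest k) (over-mono n pc k))
    where
    open Algebra.Properties.Ring ring using (-‿distribˡ-*)
    c = r n
    μ = mono n c
    -- As d is monic, the coefficient of d ⋆ r at m + n is c itself; c may be 0, since n + 1 only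
    -- bounds the length of r.
    pc : P c
    pc = resp (trans (proj₁ (⋆-top td (refl , r≥))) (*-identityˡ c)) (p (m ℕ.+ n))
    r′ : Series
    r′ = r ⊞ negS μ
    module S = CommutativeRing seriesRing
    d⋆r′ : d ⋆ r′ ≐ d ⋆ r ⊞ negS (d ⋆ μ)
    d⋆r′ = S.trans (S.distribˡ d r (negS μ)) (S.+-congˡ {d ⋆ r} (S.sym (Algebra.Properties.Ring.-‿distribʳ-* S.ring d μ)))
    r′≥ : ∀ k → n ≤ k → r′ k ≈ 0#
    r′≥ k n≤k with ℕ.m≤n⇒m<n∨m≡n n≤k
    ... | inj₁ n<k = trans (+-cong (r≥ k n<k) (-‿cong (mono-≢ {n} c k (λ { ≡.refl → ℕ.<-irrefl ≡.refl n<k })))) (-‿inverseʳ 0#)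
    ... | inj₂ ≡.refl = trans (+-congˡ (-‿cong (mono-diag n c))) (-‿inverseʳ c)
    rest : Over r′
    rest = over-quotient td pd n r′ r′≥
      (λ k → resp (sym (at d⋆r′ k)) (add (p k) (neg (over-⋆ pd (over-mono n pc) k))))
    restore : r′ k + μ k ≈ r k
    restore = trans (+-assoc _ _ _) (trans (+-congˡ (-‿inverseˡ _)) (+-identityʳ _))

record IsDiscreteDomain (R : CommutativeRing 0ℓ 0ℓ) : Set where
  open CommutativeRing R
  field
    1≉0              : ¬ 1# ≈ 0#
    _≟0              : ∀ a → Dec (a ≈ 0#)
    no-zero-divisors : ∀ {a b} → a * b ≈ 0# → ¬ b ≈ 0# → a ≈ 0#

-- Degrees and leading coefficients of polynomials over a domain.

module DomainPoly (A : CommutativeRing 0ℓ 0ℓ) (A-domain : IsDiscreteDomain A) where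
  open CommutativeRing A
  open IsDiscreteDomain A-domain
  open PowerSeries A
  open ListPoly A
  open PolyOps 0# _+_ _*_
  open Fractions polyRing using (Regular)
  open Divisors polyRing using (prod)
  open SetoidReasoning setoid
  open NatSolver commutativeSemiring using (solve; con; _:=_; _:+_; _:*_)
  private
    module P = CommutativeRing polyRing
    module BA = Bracket A
  open BA using () renaming (_^_ to _^ₐ_)

  record HasTop (p : List Carrier) (m : ℕ) (c : Carrier) : Set where
    constructor hasTop
    field series-top : Top ⟦ p ⟧ m c
  open HasTop public

  coeff-top : ∀ {p m c} → HasTop p m c → coeff m p ≈ c
  coeff-top (hasTop (eq , _)) = eq

  coeff> : ∀ {p m c} → HasTop p m c → ∀ k → m < k → coeff k p ≈ 0#
  coeff> (hasTop (_ , z)) = z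

  *-top : ∀ {p q m n a b} → HasTop p m a → HasTop q n b → HasTop (mulP p q) (m ℕ.+ n) (a * b)
  *-top {p} {q} (hasTop tp) (hasTop tq) = hasTop (top-resp (ext λ k → sym (at (⟦⟧-mulP p q) k)) refl (⋆-top tp tq))

  +-top : ∀ {p q m a b} → HasTop p m a → HasTop q m b → HasTop (addP p q) m (a + b)
  +-top {p} {q} (hasTop tp) (hasTop tq) = hasTop (top-resp (ext λ k → sym (at (⟦⟧-addP p q) k)) refl (⊞-top tp tq))

  ≋-top : ∀ {p q m a b} → p ≋ q → a ≈ b → HasTop p m a → HasTop q m b
  ≋-top p≋q a≈b (hasTop t) = hasTop (top-resp (coeffs-≐ p≋q) a≈b t)

  -- Decidable equality with 0 is needed to look past trailing zeros for the true leading term.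
  zero-or-top : ∀ p → p ≋ [] ⊎ ∃[ m ] ∃[ c ] (¬ c ≈ 0#) × HasTop p m c
  zero-or-top [] = inj₁ P.refl
  zero-or-top (a ∷ p) with zero-or-top p
  ... | inj₂ (m , c , c≉0 , hasTop (eq , z)) =
    inj₂ (suc m , c , c≉0 , hasTop (eq , λ { (suc k) (s≤s m<k) → z k m<k }))
  ... | inj₁ (coeffs z) with a ≟0
  ...   | yes a≈0 = inj₁ (coeffs (ext λ { zero → a≈0 ; (suc k) → at z k }))
  ...   | no  a≉0 = inj₂ (0 , a , a≉0 , hasTop (refl , λ { (suc k) _ → at z k }))

  top-unique : ∀ {p m n a b} → HasTop p m a → HasTop p n b → ¬ a ≈ 0# → ¬ b ≈ 0# → m ≡ n
  top-unique {p} {m} {n} tm tn a≉0 b≉0 with ℕ.<-cmp m n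
  ... | tri< m<n _ _ = contradiction (trans (sym (coeff-top tn)) (coeff> tm n m<n)) b≉0
  ... | tri≈ _ m≡n _ = m≡n
  ... | tri> _ _ n<m = contradiction (trans (sym (coeff-top tm)) (coeff> tn m n<m)) a≉0

  -- If (x - y)p = 0 with x - y nonzero, the product of two nonzero leading coefficients would
  -- vanish.
  top-regular : ∀ {p m c} → HasTop p m c → ¬ c ≈ 0# → Regular p
  top-regular {p} tp c≉0 {x} {y} eq with zero-or-top (addP x (negP y))
  ... | inj₁ z = x∙y⁻¹≈ε⇒x≈y x y z
    where open Algebra.Properties.Ring P.ring
  ... | inj₂ (n , d , d≉0 , td) = contradiction
    (no-zero-divisors (trans (sym (coeff-top (*-top td tp))) (at (coeffs-≐ zero-product) _)) c≉0) d≉0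
    where
    open Algebra.Properties.Ring P.ring
    zero-product : mulP (addP x (negP y)) p ≋ []
    zero-product = P.trans ([y-z]x≈yx-zx p x y) (x≈y⇒x∙y⁻¹≈ε eq)

  monic-quotient : ∀ {p w u m n} → HasTop p m 1# → HasTop u n 1# → mulP p w ≋ u →
                   ∃[ k ] n ≡ m ℕ.+ k × HasTop w k 1#
  monic-quotient {p} {w} {u} {m} {n} tp tu eq with zero-or-top w
  ... | inj₁ w≋0 = contradiction
    (trans (sym (coeff-top tu)) (at (coeffs-≐ (P.trans (P.sym eq) (P.trans (P.*-congˡ {p} w≋0) (P.zeroʳ p)))) n)) 1≉0
  ... | inj₂ (k , c , c≉0 , tw) = k , n≡m+k , ≋-top P.refl c≈1 tw
    where
    tpw : HasTop u (m ℕ.+ k) c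
    tpw = ≋-top eq (*-identityˡ c) (*-top tp tw)
    n≡m+k : n ≡ m ℕ.+ k
    n≡m+k = top-unique tu tpw 1≉0 c≉0
    c≈1 : c ≈ 1#
    c≈1 = trans (sym (coeff-top tpw)) (trans (reflexive (≡.cong ⟦ u ⟧ (≡.sym n≡m+k))) (coeff-top tu))

  top-0⇒≋1 : ∀ {p} → HasTop p 0 1# → p ≋ 1# ∷ []
  top-0⇒≋1 t = coeffs (ext λ { zero → coeff-top t ; (suc k) → coeff> t (suc k) (s≤s z≤n) })

  -- Mutual divisibility forces equal degrees, so the quotient is monic of degree 0, that is, 1.
  monic-antisym : ∀ {a b s t m n} → HasTop a m 1# → HasTop b n 1# → mulP a s ≋ b → mulP b t ≋ a → a ≋ b
  monic-antisym {a} {b} {s} {t} {m} {n} ta tb p q with monic-quotient ta tb p | monic-quotient tb ta q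
  ... | zero  , _ , ts | _ = P.trans (P.sym (P.trans (P.*-congˡ {a} (top-0⇒≋1 ts)) (P.*-identityʳ a))) p
  ... | suc k , ≡.refl , _ | l , eq , _ =
    contradiction (≡.trans eq (≡.trans (ℕ.+-assoc m (suc k) l) (ℕ.+-suc m (k ℕ.+ l)))) (ℕ.m≢1+m+n m)

  last-top : ∀ p {c} → last p ≡ just c → HasTop p (ℕ.pred (length p)) c
  last-top (a ∷ [])    ≡.refl = hasTop (refl , λ { (suc k) _ → refl })
  last-top (a ∷ b ∷ p) eq with last-top (b ∷ p) eq
  ... | hasTop (eq′ , z) = hasTop (eq′ , λ { (suc k) (s≤s m<k) → z k m<k })

  X : List Carrier
  X = 0# ∷ 1# ∷ []

  open Bracket polyRing using (bracket; _^_) public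

  X*-zero : ∀ p → coeff 0 (mulP X p) ≈ 0#
  X*-zero p = trans (at (⟦⟧-mulP X p) 0) (zeroˡ _)

  X*-suc : ∀ p k → coeff (suc k) (mulP X p) ≈ coeff k p
  X*-suc p k = trans (at (⟦⟧-mulP X p) (suc k)) (trans (+-cong (zeroˡ _)
    (trans (at (⋆-cong ⟦1⟧ (ext λ _ → refl)) k) (at (⋆-identityˡ ⟦ p ⟧) k))) (+-identityˡ _))

  1+X* : ∀ p → addP (1# ∷ []) (mulP X p) ≋ 1# ∷ p
  1+X* p = coeffs (ext λ
    { zero    → trans (at (⟦⟧-addP (1# ∷ []) (mulP X p)) 0) (trans (+-congˡ (X*-zero p)) (+-identityʳ _))
    ; (suc k) → trans (at (⟦⟧-addP (1# ∷ []) (mulP X p)) (suc k)) (trans (+-identityˡ _) (X*-suc p k)) })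

  bracket-X : ∀ n → bracket X n ≋ replicate n 1#
  bracket-X zero    = P.refl
  bracket-X (suc n) = P.trans (P.+-congˡ {1# ∷ []} (P.*-congˡ {X} (bracket-X n))) (1+X* (replicate n 1#))

  bracket-top : ∀ n → HasTop (bracket X (suc n)) n 1#
  bracket-top n = ≋-top (P.sym (bracket-X (suc n))) refl (go n)
    where
    go : ∀ n → HasTop (replicate (suc n) 1#) n 1#
    go zero    = hasTop (refl , λ { (suc k) _ → refl })
    go (suc n) = hasTop (coeff-top (go n) , λ { (suc k) (s≤s n<k) → coeff> (go n) k n<k })

  one-top : HasTop (1# ∷ []) 0 1#
  one-top = hasTop (top-resp (ext λ k → sym (at ⟦1⟧ k)) refl top-one)

  ^-top : ∀ {p m a} k → HasTop p m a → HasTop (p ^ k) (k ℕ.* m) (a ^ₐ k)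
  ^-top zero    t = one-top
  ^-top (suc k) t = *-top t (^-top k t)

  neg-top : ∀ {p m a} → HasTop p m a → HasTop (negP p) m (- a)
  neg-top {p} (hasTop (eq , z)) = hasTop
    ( trans (at (⟦⟧-negP p) _) (-‿cong eq)
    , λ k m<k → trans (at (⟦⟧-negP p) k) (trans (-‿cong (z k m<k)) -0#≈0#) )
    where open Algebra.Properties.Ring ring using (-0#≈0#)

  zero-top : ∀ m → HasTop [] m 0#
  zero-top m = hasTop (refl , λ _ _ → refl)

  raise-top : ∀ {p m n a} → m < n → HasTop p m a → HasTop p n 0#
  raise-top m<n t = hasTop (coeff> t _ m<n , λ k n<k → coeff> t k (ℕ.<-trans m<n n<k))

  nat-top : ∀ n → HasTop (bracket (1# ∷ []) n) 0 (BA.bracket 1# n)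
  nat-top zero    = zero-top 0
  nat-top (suc n) = +-top one-top (*-top one-top (nat-top n))

  prod-monic : ∀ {f} → (∀ j → ∃[ m ] HasTop (f (suc j)) m 1#) → ∀ n → ∃[ m ] HasTop (prod f n) m 1#
  prod-monic f-monic zero = 0 , one-top
  prod-monic f-monic (suc n) =
    _ , ≋-top P.refl (*-identityʳ 1#) (*-top (proj₂ (prod-monic f-monic n)) (proj₂ (f-monic n)))

  bracket-gcd-monic : ∀ n j → ∃[ m ] HasTop (bracket X (gcd (suc j) n)) m 1#
  bracket-gcd-monic n j with gcd (suc j) n in eq
  ... | zero  = contradiction eq (gcd[m,n]≢0 (suc j) n (inj₁ λ ()))
  ... | suc m = m , bracket-top m

  1-X : List Carrier
  1-X = 1# ∷ - 1# ∷ []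

  1-X+X : addP 1-X X ≋ 1# ∷ []
  1-X+X = coeffs (ext λ { zero → +-identityʳ 1# ; (suc zero) → -‿inverseˡ 1# ; (suc (suc k)) → refl })

  1-X*-suc : ∀ p k → coeff (suc k) (mulP 1-X p) ≈ coeff (suc k) p + - 1# * coeff k p
  1-X*-suc p k = trans (at (⟦⟧-mulP 1-X p) (suc k))
    (+-cong (*-identityˡ _) (⋆-constˡ ⟦ - 1# ∷ [] ⟧ ⟦ p ⟧ (λ _ → refl) k))

  1-X^-top : ∀ n → HasTop (1-X ^ n) n ((- 1#) ^ₐ n)
  1-X^-top n = ≡.subst (λ m → HasTop (1-X ^ n) m ((- 1#) ^ₐ n)) (ℕ.*-identityʳ n)
    (^-top n (hasTop (refl , λ { (suc zero) (s≤s ()) ; (suc (suc k)) _ → refl })))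

  -- The second-highest binomial coefficient with its sign, obtained by a Pascal step. It is needed
  -- because the highest coefficient cancels against that of [n+2].
  1-X^-coeff : ∀ n → coeff n (1-X ^ suc n) ≈ BA.bracket 1# (suc n) * (- 1#) ^ₐ n
  1-X^-coeff zero    = trans (at (⟦⟧-mulP 1-X (1# ∷ [])) 0) (solve 0 (con 1 :* con 1 := (con 1 :+ con 1 :* con 0) :* con 1) refl)
  1-X^-coeff (suc n) = begin
    coeff (suc n) (mulP 1-X (1-X ^ suc n))
      ≈⟨ 1-X*-suc (1-X ^ suc n) n ⟩
    coeff (suc n) (1-X ^ suc n) + - 1# * coeff n (1-X ^ suc n)
      ≈⟨ +-cong (coeff-top (1-X^-top (suc n))) (*-congˡ (1-X^-coeff n)) ⟩
    - 1# * (- 1#) ^ₐ n + - 1# * (BA.bracket 1# (suc n) * (- 1#) ^ₐ n)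
      ≈⟨ solve 3 (λ s p b → s :* p :+ s :* (b :* p) := (con 1 :+ con 1 :* b) :* (s :* p)) refl _ _ _ ⟩
    BA.bracket 1# (suc (suc n)) * (- 1#) ^ₐ suc n ∎

  -1*-1* : ∀ a → - 1# * (- 1# * a) ≈ a
  -1*-1* a = trans (-1*x≈-x _) (trans (-‿cong (-1*x≈-x a)) (-‿involutive a))
    where open Algebra.Properties.Ring ring using (-1*x≈-x; -‿involutive)

  sign : ℕ → List Carrier
  sign n = negP (1# ∷ []) ^ n

  sign-top : ∀ n → HasTop (sign n) 0 ((- 1#) ^ₐ n)
  sign-top n = ≡.subst (λ m → HasTop (sign n) m ((- 1#) ^ₐ n)) (ℕ.*-zeroʳ n) (^-top n (neg-top one-top))

  -- The coefficients of X^(n+1) in (1 − X)^(n+1) and (−1)ⁿ[n+2] cancel, those of Xⁿ add up.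
  cancelling-top : ∀ n → HasTop (addP (1-X ^ suc n) (mulP (sign (suc (suc n))) (bracket X (suc (suc n)))))
                                n (BA.bracket 1# (suc (suc n)) * (- 1#) ^ₐ suc (suc n))
  cancelling-top n = hasTop (at-n , above)
    where
    s = (- 1#) ^ₐ n
    σ = sign (suc (suc n))
    b = bracket X (suc (suc n))
    split : ∀ k → coeff k (addP (1-X ^ suc n) (mulP σ b)) ≈ coeff k (1-X ^ suc n) + s * coeff k b
    split k = trans (at (⟦⟧-addP (1-X ^ suc n) (mulP σ b)) k) (+-congˡ
      (trans (at (⟦⟧-mulP σ b) k) (trans (⋆-constˡ ⟦ σ ⟧ ⟦ b ⟧ (λ k → coeff> (sign-top (suc (suc n))) (suc k) (s≤s z≤n)) k)
        (*-congʳ (trans (coeff-top (sign-top (suc (suc n)))) (-1*-1* s))))))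
    b-n : ∀ n → coeff n (replicate (suc (suc n)) 1#) ≈ 1#
    b-n zero    = refl
    b-n (suc n) = b-n n
    at-n : coeff n (addP (1-X ^ suc n) (mulP σ b)) ≈ BA.bracket 1# (suc (suc n)) * (- 1#) ^ₐ suc (suc n)
    at-n = begin
      coeff n (addP (1-X ^ suc n) (mulP σ b))    ≈⟨ split n ⟩
      coeff n (1-X ^ suc n) + s * coeff n b
        ≈⟨ +-cong (1-X^-coeff n) (*-congˡ (trans (at (coeffs-≐ (bracket-X (suc (suc n)))) n) (b-n n))) ⟩
      BA.bracket 1# (suc n) * s + s * 1#
        ≈⟨ solve 2 (λ b s → b :* s :+ s :* con 1 := (con 1 :+ con 1 :* b) :* s) refl _ _ ⟩
      BA.bracket 1# (suc (suc n)) * s            ≈⟨ *-congˡ (-1*-1* s) ⟨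
      BA.bracket 1# (suc (suc n)) * (- 1#) ^ₐ suc (suc n) ∎
    above : ∀ k → n < k → coeff k (addP (1-X ^ suc n) (mulP σ b)) ≈ 0#
    above k n<k with ℕ.m≤n⇒m<n∨m≡n n<k
    ... | inj₁ 1+n<k = trans (split k) (trans (+-cong (coeff> (1-X^-top (suc n)) k 1+n<k)
      (trans (*-congˡ (coeff> (bracket-top (suc n)) k 1+n<k)) (zeroʳ s))) (+-identityʳ 0#))
    ... | inj₂ ≡.refl = begin
      coeff (suc n) (addP (1-X ^ suc n) (mulP σ b))        ≈⟨ split (suc n) ⟩
      coeff (suc n) (1-X ^ suc n) + s * coeff (suc n) b
        ≈⟨ +-cong (coeff-top (1-X^-top (suc n))) (*-congˡ (coeff-top (bracket-top (suc n)))) ⟩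
      - 1# * s + s * 1#
        ≈⟨ solve 2 (λ m s → m :* s :+ s :* con 1 := (m :+ con 1) :* s) refl _ _ ⟩
      (- 1# + 1#) * s                                      ≈⟨ trans (*-congʳ (-‿inverseˡ 1#)) (zeroˡ s) ⟩
      0# ∎

-- `K` stands for the field of rational functions, `J k` for 1/[k+1] and `F k` for 1/[k]!. The
-- argument relies only on these relations and on `ι` being injective, never on how fractions are
-- built.
record QExponentialExpansion (A : CommutativeRing 0ℓ 0ℓ) (A-domain : IsDiscreteDomain A) : Set₁ where
  open DomainPoly A A-domain using (bracket; X)
  field
    K        : CommutativeRing 0ℓ 0ℓ
  open CommutativeRing K
  field
    ι        : List (CommutativeRing.Carrier A) → Carrier
    ι-mono   : IsRingMonomorphism (CommutativeRing.rawRing (ListPoly.polyRing A)) rawRing ι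
    J        : ℕ → Carrier
    J-inv    : ∀ k → J k * ι (bracket X (suc k)) ≈ 1#
    e F      : ℕ → Carrier
    F-zero   : F 0 ≈ 1#
    F-suc    : ∀ k → ι (bracket X (suc k)) * F (suc k) ≈ F k
    expands  : ∀ n → LogDerivative.PowerProduct.partialProduct K e (suc n) (suc n) ≈ F (suc n)

-- The numerators rₙ: existence, degree and leading coefficient.

module Numerators (A : CommutativeRing 0ℓ 0ℓ) (A-domain : IsDiscreteDomain A)
  (E : QExponentialExpansion A A-domain) where
  private module A = CommutativeRing A
  open ListPoly A
  open PolyOps A.0# A._+_ A._*_
  open DomainPoly A A-domain
  open Divisors polyRing using (prod; gcdProduct; gcdProduct-^∣)
  open QExponentialExpansion E
  open CommutativeRing K
  open SetoidReasoning setoid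
  open NatSolver commutativeSemiring using (solve; con; _:=_; _:+_; _:*_)
  open IsRingMonomorphism ι-mono using (injective; +-homo; *-homo; -‿homo; 0#-homo; 1#-homo) renaming (⟦⟧-cong to ι-cong)
  open Algebra.Properties.Ring ring using (-1*x≈-x; -‿distribʳ-*; -‿+-comm)
  open Algebra.Properties.CommutativeSemiring.Exp commutativeSemiring using (^-distrib-*; ^-congˡ)
  open LogDerivative K
  open PowerProduct e
  private
    module BA = Bracket A
    module BK = Bracket K
    module P = CommutativeRing polyRing
  open BA using () renaming (_^_ to _^ₐ_)
  open BK using () renaming (_^_ to _^ₖ_)

  ι-^ : ∀ p n → ι (p ^ n) ≈ ι p ^ₖ n
  ι-^ p zero    = 1#-homo
  ι-^ p (suc n) = trans (*-homo p (p ^ n)) (*-congˡ (ι-^ p n))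

  ι-bracket : ∀ p n → ι (bracket p n) ≈ BK.bracket (ι p) n
  ι-bracket p zero    = 0#-homo
  ι-bracket p (suc n) = trans (+-homo (A.1# ∷ []) (mulP p (bracket p n)))
    (+-cong 1#-homo (trans (*-homo p (bracket p n)) (*-congˡ (ι-bracket p n))))

  bracket-cong : ∀ {x y} n → x ≈ y → BK.bracket x n ≈ BK.bracket y n
  bracket-cong zero    p = refl
  bracket-cong (suc n) p = +-congˡ (*-cong p (bracket-cong n p))

  ι-nat : ∀ n → ι (bracket (A.1# ∷ []) n) ≈ nat n
  ι-nat n = trans (ι-bracket (A.1# ∷ []) n) (bracket-cong n 1#-homo)

  log-coeff : ℕ → Carrier
  log-coeff zero    = 0#
  log-coeff (suc k) = ι 1-X ^ₖ k * J k

  logSum-qexp : ∀ n → logSum n n ≈ log-coeff n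
  logSum-qexp = logSum-coeff F-zero expands (qexp-log
    (trans (sym (+-homo 1-X X)) (trans (ι-cong 1-X+X) 1#-homo)) J
    (λ k → trans (*-congˡ (sym (ι-bracket X (suc k)))) (J-inv k))
    (λ k → trans (*-congʳ (sym (ι-bracket X (suc k)))) (F-suc k))
    refl
    (λ k → begin
      BK.bracket (ι X) (suc k) * (ι 1-X ^ₖ k * J k)
        ≈⟨ *-congʳ (ι-bracket X (suc k)) ⟨
      ι (bracket X (suc k)) * (ι 1-X ^ₖ k * J k)
        ≈⟨ solve 3 (λ b p j → b :* (p :* j) := p :* (j :* b)) refl _ _ _ ⟩
      ι 1-X ^ₖ k * (J k * ι (bracket X (suc k)))
        ≈⟨ trans (*-congˡ (J-inv k)) (*-identityʳ _) ⟩
      ι 1-X ^ₖ k ∎))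

  -- The term d = 1 enters with this explicit value, as r₁ = u₁ = 1 does not have degree below u₁.
  e-one : e 1 ≈ 1#
  e-one = begin
    e 1            ≈⟨ +-identityˡ (e 1) ⟨
    0# + e 1       ≈⟨ expansion-rec {F} F-zero expands 0 ⟩
    F 1            ≈⟨ *-identityˡ (F 1) ⟨
    1# * F 1       ≈⟨ *-congʳ (trans (ι-bracket X 1) (solve 1 (λ x → con 1 :+ x :* con 0 := con 1) refl (ι X))) ⟨
    ι (bracket X 1) * F 1   ≈⟨ F-suc 0 ⟩
    F 0            ≈⟨ F-zero ⟩
    1# ∎

  u : ℕ → List A.Carrier
  u = gcdProduct X

  -- The value c = 0 is allowed and marks contributions that are invisible at degree U.
  record Numerator (n U : ℕ) (x : Carrier) (c : A.Carrier) : Set where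
    constructor numerator
    field
      poly     : List A.Carrier
      cleared  : ι (u n) * x ≈ ι poly
      poly-top : HasTop poly U c
  open Numerator public

  numerator-resp : ∀ {n U x y c d} → x ≈ y → c A.≈ d → Numerator n U x c → Numerator n U y d
  numerator-resp x≈y c≈d (numerator r eq t) = numerator r (trans (*-congˡ (sym x≈y)) eq) (≋-top P.refl c≈d t)

  numerator-+ : ∀ {n U x y c d} → Numerator n U x c → Numerator n U y d → Numerator n U (x + y) (c A.+ d)
  numerator-+ (numerator r eq t) (numerator r′ eq′ t′) = numerator (addP r r′)
    (trans (distribˡ _ _ _) (trans (+-cong eq eq′) (sym (+-homo r r′)))) (+-top t t′)

  numerator-neg : ∀ {n U x c} → Numerator n U x c → Numerator n U (- x) (A.- c)
  numerator-neg (numerator r eq t) = numerator (negP r)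
    (trans (sym (-‿distribʳ-* _ _)) (trans (-‿cong eq) (sym (-‿homo r)))) (neg-top t)

  numerator-scale : ∀ {n U x c p a} → HasTop p 0 a → Numerator n U x c → Numerator n U (ι p * x) (a A.* c)
  numerator-scale {p = p} tp (numerator r eq t) = numerator (mulP p r)
    (trans (solve 3 (λ u p x → u :* (p :* x) := p :* (u :* x)) refl _ _ _) (trans (*-congˡ eq) (sym (*-homo p r))))
    (*-top tp t)

  numerator-zero : ∀ n U → Numerator n U 0# A.0#
  numerator-zero n U = numerator [] (trans (zeroʳ _) (sym 0#-homo)) (zero-top U)

  -- The d-th summand of the logarithmic derivative, cleared of its denominator, is
  -- w·d·r(−r)^(m−1) with uₙ = w·(u_d)^m; each of its m factors r has degree one below u_d.
  proper-divisor-term : ∀ {n d U Ud} → d < n →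
    HasTop (u n) (suc U) A.1# → HasTop (u d) (suc Ud) A.1# → ∀ {c} → Numerator d Ud (e d) c →
    d ∣ₙ n → 0 < d → Numerator n U (factorLog d n) A.0#
  proper-divisor-term d<n _ _ _ (divides zero ≡.refl) _ = contradiction d<n λ ()
  proper-divisor-term {d = d} d<n _ _ _ (divides (suc zero) eq) _ =
    contradiction (≡.trans (≡.sym (ℕ.+-identityʳ d)) (≡.sym eq)) (ℕ.<⇒≢ d<n)
  proper-divisor-term {d = d} {U} {Ud} d<n tu tud (numerator r eq tr) (divides m@(suc m′@(suc m″)) ≡.refl) (s≤s {n = d-1} _) =
    numerator (mulP w (mulP δ (mulP r (negP r ^ m′)))) clears
      (raise-top degree (*-top tw (*-top (nat-top d) (*-top tr (^-top m′ (neg-top tr))))))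
    where
    open Algebra.Properties.Monoid.Divisibility P.*-monoid
    δ = bracket (A.1# ∷ []) d
    w : List A.Carrier
    w = _∣ʳ_.quotient (gcdProduct-^∣ X m d)
    w* : mulP w (u d ^ m) ≋ u (m ℕ.* d)
    w* = _∣ʳ_.equality (gcdProduct-^∣ X m d)
    tud^ : HasTop (u d ^ m) (m ℕ.* suc Ud) A.1#
    tud^ = ≋-top P.refl (BA.one^ m) (^-top m tud)
    w-monic = monic-quotient tud^ tu (P.trans (P.*-comm (u d ^ m) w) w*)
    W = proj₁ w-monic
    tw = proj₂ (proj₂ w-monic)
    -- From U + 1 = m(Ud + 1) + W, the degree W + m·Ud falls short of U by m - 1 = m″ + 1. This is
    -- where m ≥ 2 enters.
    degree : W ℕ.+ (0 ℕ.+ (Ud ℕ.+ m′ ℕ.* Ud)) < U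
    degree = ≡.subst (W ℕ.+ (Ud ℕ.+ m′ ℕ.* Ud) <_)
      (≡.trans (rearrange W Ud m″) (≡.sym (ℕ.suc-injective (proj₁ (proj₂ w-monic)))))
      (s≤s (ℕ.m≤m+n _ m″))
      where
      open +-*-Solver renaming (solve to solveℕ; con to conℕ; _:=_ to _⊜_; _:+_ to _⊞_; _:*_ to _⊠_)
      rearrange : ∀ W Ud m″ → suc (W ℕ.+ (Ud ℕ.+ suc m″ ℕ.* Ud) ℕ.+ m″) ≡ Ud ℕ.+ suc m″ ℕ.* suc Ud ℕ.+ W
      rearrange = solveℕ 3 (λ W Ud m → conℕ 1 ⊞ (W ⊞ (Ud ⊞ (conℕ 1 ⊞ m) ⊠ Ud) ⊞ m) ⊜ Ud ⊞ (conℕ 1 ⊞ m) ⊠ (conℕ 1 ⊞ Ud) ⊞ W) ≡.refl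
    clears : ι (u (m ℕ.* d)) * factorLog d (m ℕ.* d) ≈ ι (mulP w (mulP δ (mulP r (negP r ^ m′))))
    clears = begin
      ι (u (m ℕ.* d)) * factorLog d (m ℕ.* d)
        ≈⟨ *-cong (trans (ι-cong (P.sym w*)) (trans (*-homo w (u d ^ m)) (*-congˡ (ι-^ (u d) m)))) (factorLog-* d-1 m) ⟩
      ι w * (ι (u d) * ι (u d) ^ₖ m′) * (nat d * e d * (- e d) ^ₖ m′)
        ≈⟨ solve 6 (λ w a p d e s → w :* (a :* p) :* (d :* e :* s) := w :* (d :* (a :* e :* (p :* s)))) refl _ _ _ _ _ _ ⟩
      ι w * (nat d * (ι (u d) * e d * (ι (u d) ^ₖ m′ * (- e d) ^ₖ m′)))
        ≈⟨ *-congˡ (*-cong (sym (ι-nat d)) (*-cong eq (trans (sym (^-distrib-* _ _ m′)) (trans (^-congˡ m′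
             (trans (sym (-‿distribʳ-* _ _)) (trans (-‿cong eq) (sym (-‿homo r))))) (sym (ι-^ (negP r) m′)))))) ⟩
      ι w * (ι δ * (ι r * ι (negP r ^ m′)))
        ≈⟨ *-congˡ (*-congˡ (*-homo r _)) ⟨
      ι w * (ι δ * ι (mulP r (negP r ^ m′)))
        ≈⟨ *-congˡ (*-homo δ _) ⟨
      ι w * ι (mulP δ (mulP r (negP r ^ m′)))
        ≈⟨ *-homo w _ ⟨
      ι (mulP w (mulP δ (mulP r (negP r ^ m′)))) ∎

  -- Beyond polynomiality, the induction has to carry the exact gap of one between the degrees of uₙ
  -- and rₙ.
  NumeratorClaim : ℕ → Set
  NumeratorClaim n = ∃[ U ] HasTop (u n) (suc U) A.1# × Numerator n U (e n) ((A.- A.1#) ^ₐ n)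

  module _ (nat-inverse : ∀ n → ∃[ y ] y A.* BA.bracket A.1# (suc n) A.≈ A.1#) where

    -- The divisor relation is solved for N·e N. Only the right-hand side and the term d = 1
    -- contribute at degree U, giving N(-1)^N before the division by N.
    numerator-step : ∀ n → (∀ d → 2 ≤ d → d < suc (suc n) → NumeratorClaim d) → NumeratorClaim (suc (suc n))
    numerator-step n ih = U , tu , numerator-resp (sym e-solved) top-solved
        (numerator-scale ty (partial n ℕ.≤-refl))
      where
      N = suc (suc n)
      f = λ j → bracket X (gcd j N)
      -- The last factor of `u N` is [N], so v is `u N`/[N]; that factor clears the denominator of
      -- `log-coeff N`.
      v = prod f (suc n)
      v-monic = prod-monic {f} (bracket-gcd-monic N) (suc n)
      V = proj₁ v-monic
      U = V ℕ.+ n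
      g = addP (1-X ^ suc n) (mulP (sign N) (bracket X N))
      gcd-self : gcd N N ≡ N
      gcd-self = ℕ.∣-antisym (gcd[m,n]∣m N N) (gcd-greatest ℕ.∣-refl ℕ.∣-refl)
      uN : u N ≋ mulP v (bracket X N)
      uN = P.*-congˡ {v} (P.reflexive (≡.cong (bracket X) gcd-self))
      tu : HasTop (u N) (suc U) A.1#
      tu = ≡.subst (λ k → HasTop (u N) k A.1#) (ℕ.+-suc V n)
        (≋-top (P.sym uN) (A.*-identityʳ A.1#) (*-top (proj₂ v-monic) (bracket-top (suc n))))
      c = BA.bracket A.1# N A.* (A.- A.1#) ^ₐ N

      -- With e 1 = 1 the term d = 1 is (-1)^(N-1); moving it to the other side yields (-1)^N.
      factorLog-one : - factorLog 1 N ≈ ι (sign N)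
      factorLog-one = begin
        - factorLog 1 N
          ≡⟨ ≡.cong (λ k → - factorLog 1 k) (ℕ.*-identityʳ N) ⟨
        - factorLog 1 (N ℕ.* 1)
          ≈⟨ -‿cong (factorLog-* 0 N) ⟩
        - ((1# + 1# * 0#) * e 1 * (- e 1) ^ₖ suc n)
          ≈⟨ -‿cong (*-cong (*-congˡ e-one) (^-congˡ (suc n) (-‿cong e-one))) ⟩
        - ((1# + 1# * 0#) * 1# * (- 1#) ^ₖ suc n)
          ≈⟨ -‿cong (solve 1 (λ s → (con 1 :+ con 1 :* con 0) :* con 1 :* s := s) refl _) ⟩
        - ((- 1#) ^ₖ suc n)
          ≈⟨ -1*x≈-x _ ⟨
        (- 1#) ^ₖ N
          ≈⟨ ^-congˡ N (trans (-‿homo _) (-‿cong 1#-homo)) ⟨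
        ι (negP (A.1# ∷ [])) ^ₖ N
          ≈⟨ ι-^ _ N ⟨
        ι (sign N) ∎

      first : Numerator N U (log-coeff N + - logSum 1 N) c
      first = numerator (mulP v g) (begin
        ι (u N) * (ι 1-X ^ₖ suc n * J (suc n) + - (0# + factorLog 1 N))
          ≈⟨ *-cong (trans (ι-cong uN) (*-homo v _)) (+-congˡ (trans (-‿cong (+-identityˡ _)) factorLog-one)) ⟩
        ι v * ι (bracket X N) * (ι 1-X ^ₖ suc n * J (suc n) + ι (sign N))
          ≈⟨ solve 5 (λ v b o j s → v :* b :* (o :* j :+ s) := v :* (o :* (j :* b) :+ s :* b)) refl _ _ _ _ _ ⟩
        ι v * (ι 1-X ^ₖ suc n * (J (suc n) * ι (bracket X N)) + ι (sign N) * ι (bracket X N))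
          ≈⟨ *-congˡ (+-cong (trans (*-congˡ (J-inv (suc n))) (trans (*-identityʳ _) (sym (ι-^ 1-X (suc n)))))
               (sym (*-homo (sign N) _))) ⟩
        ι v * (ι (1-X ^ suc n) + ι (mulP (sign N) (bracket X N)))
          ≈⟨ *-congˡ (+-homo (1-X ^ suc n) _) ⟨
        ι v * ι g
          ≈⟨ *-homo v g ⟨
        ι (mulP v g) ∎)
        (≋-top P.refl (A.*-identityˡ c) (*-top (proj₂ v-monic) (cancelling-top n)))

      term : ∀ d → 2 ≤ d → d < N → Numerator N U (factorLog d N) A.0#
      term d 2≤d d<N = by-cases (d ∣ₙ? N)
        where
        d-claim = ih d 2≤d d<N
        by-cases : Dec (d ∣ₙ N) → Numerator N U (factorLog d N) A.0#
        by-cases (no d∤N)  = numerator-resp (sym (factorLog-∤ d∤N)) A.refl (numerator-zero N U)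
        by-cases (yes d∣N) = proper-divisor-term d<N tu (proj₁ (proj₂ d-claim)) (proj₂ (proj₂ d-claim)) d∣N
                               (ℕ.<-trans (s≤s z≤n) 2≤d)

      -- Each further divisor has coefficient 0 at degree U, so subtracting it leaves c unchanged.
      partial : ∀ i → i ≤ n → Numerator N U (log-coeff N + - logSum (suc i) N) c
      partial zero    _   = first
      partial (suc i) i<n = numerator-resp
        (trans (+-assoc _ _ _) (+-congˡ (-‿+-comm _ _)))
        (A.trans (A.+-congˡ -0#≈0#) (A.+-identityʳ c))
        (numerator-+ (partial i (ℕ.<⇒≤ i<n)) (numerator-neg (term (suc (suc i)) (s≤s (s≤s z≤n)) (s≤s (s≤s i<n)))))
        where open Algebra.Properties.Ring A.ring using (-0#≈0#)

      -- y is 1/N, used below as a constant polynomial; it cancels the factor N of c.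
      y = proj₁ (nat-inverse (suc n))
      ty : HasTop (y ∷ []) 0 y
      ty = hasTop (A.refl , λ { (suc k) _ → A.refl })

      top-solved : y A.* c A.≈ (A.- A.1#) ^ₐ N
      top-solved = A.trans (A.sym (A.*-assoc _ _ _)) (A.trans (A.*-congʳ (proj₂ (nat-inverse (suc n)))) (A.*-identityˡ _))

      nat-e : nat N * e N ≈ log-coeff N + - logSum (suc n) N
      nat-e = begin
        nat N * e N                                  ≈⟨ *-identityʳ _ ⟨
        γ N 1                                        ≈⟨ factorLog-* (suc n) 1 ⟨
        factorLog N (N ℕ.+ 0)                        ≡⟨ ≡.cong (factorLog N) (ℕ.+-identityʳ N) ⟩
        factorLog N N                                ≈⟨ +-identityʳ _ ⟨
        factorLog N N + 0#                           ≈⟨ +-congˡ (-‿inverseʳ _) ⟨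
        factorLog N N + (L + - L)                    ≈⟨ solve 3 (λ a b c → a :+ (b :+ c) := (b :+ a) :+ c) refl _ _ _ ⟩
        logSum N N + - L                             ≈⟨ +-congʳ (logSum-qexp N) ⟩
        log-coeff N + - L ∎
        where L = logSum (suc n) N

      e-solved : e N ≈ ι (y ∷ []) * (log-coeff N + - logSum (suc n) N)
      e-solved = begin
        e N                                  ≈⟨ *-identityˡ _ ⟨
        1# * e N                             ≈⟨ *-congʳ 1#-homo ⟨
        ι (A.1# ∷ []) * e N
          ≈⟨ *-congʳ (ι-cong (top-0⇒≋1 (≋-top P.refl (proj₂ (nat-inverse (suc n))) (*-top ty (nat-top N))))) ⟨
        ι (mulP (y ∷ []) δ) * e N            ≈⟨ *-congʳ (trans (*-homo (y ∷ []) δ) (*-congˡ (ι-nat N))) ⟩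
        ι (y ∷ []) * nat N * e N             ≈⟨ *-assoc _ _ _ ⟩
        ι (y ∷ []) * (nat N * e N)           ≈⟨ *-congˡ nat-e ⟩
        ι (y ∷ []) * (log-coeff N + - logSum (suc n) N) ∎
        where δ = bracket (A.1# ∷ []) N

    numerator-claim : ∀ n → 2 ≤ n → NumeratorClaim n
    numerator-claim = <-rec (λ n → 2 ≤ n → NumeratorClaim n) step
      where
      step : ∀ n → (∀ {d} → d < n → 2 ≤ d → NumeratorClaim d) → 2 ≤ n → NumeratorClaim n
      step (suc (suc n)) ih _ = numerator-step n (λ d 2≤d d<n → ih d<n 2≤d)
      step (suc zero)    ih (s≤s ())

  -- Integrality of the numerators.

  module Integrality {Int : A.Carrier → Set} (int-subring : IsSubring A Int) where
    open PowerSeries A using (at; ext; negS; _⋆_)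
    open SubringSeries A int-subring
    private
      module I = IsSubring int-subring
      module SK = PowerSeries K

    integral-mulP : ∀ p q → Over ⟦ p ⟧ → Over ⟦ q ⟧ → Over ⟦ mulP p q ⟧
    integral-mulP p q ip iq k = I.resp (A.sym (at (⟦⟧-mulP p q) k)) (over-⋆ ip iq k)

    integral-addP : ∀ p q → Over ⟦ p ⟧ → Over ⟦ q ⟧ → Over ⟦ addP p q ⟧
    integral-addP p q ip iq k = I.resp (A.sym (at (⟦⟧-addP p q) k)) (I.add (ip k) (iq k))

    integral-negP : ∀ p → Over ⟦ p ⟧ → Over ⟦ negP p ⟧
    integral-negP p ip k = I.resp (A.sym (at (⟦⟧-negP p) k)) (I.neg (ip k))

    integral-one : Over ⟦ A.1# ∷ [] ⟧
    integral-one k = I.resp (A.sym (at ⟦1⟧ k)) (over-one k)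

    integral-bracket : ∀ n → Over ⟦ bracket X n ⟧
    integral-bracket n k = I.resp (A.sym (at (coeffs-≐ (bracket-X n)) k)) (ones n k)
      where
      ones : ∀ n → Over ⟦ replicate n A.1# ⟧
      ones zero    k       = I.has-0
      ones (suc n) zero    = I.has-1
      ones (suc n) (suc k) = ones n k

    integral-prod : ∀ {f} → (∀ j → Over ⟦ f j ⟧) → ∀ n → Over ⟦ prod f n ⟧
    integral-prod f-int zero    = integral-one
    integral-prod f-int (suc n) = integral-mulP (prod _ n) _ (integral-prod f-int n) (f-int (suc n))

    integral-sign : ∀ n → Over ⟦ sign n ⟧
    integral-sign zero    = integral-one
    integral-sign (suc n) = integral-mulP (negP (A.1# ∷ [])) (sign n) (integral-negP (A.1# ∷ []) integral-one) (integral-sign n)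

    -- Quotients of integral polynomials by monic integral ones. Monic polynomials are closed under
    -- products, so these elements form a subring, and a monic D can later be divided out without
    -- leaving the integral coefficients.
    record Fractional (x : Carrier) : Set where
      constructor fractional
      field
        {D p}   : List A.Carrier
        {deg}   : ℕ
        D-monic : HasTop D deg A.1#
        D-int   : Over ⟦ D ⟧
        p-int   : Over ⟦ p ⟧
        D*x     : ι D * x ≈ ι p

    fractional-subring : IsSubring K Fractional
    fractional-subring = record
      { resp  = λ { x≈y (fractional t i j eq) → fractional t i j (trans (*-congˡ (sym x≈y)) eq) }
      ; has-0 = fractional {p = []} one-top integral-one (λ _ → I.has-0) (trans (zeroʳ _) (sym 0#-homo))
      ; has-1 = fractional one-top integral-one integral-one (*-identityʳ _)
      ; add   = λ { {x} {y} (fractional {D} {p} t i j eq) (fractional {D′} {p′} t′ i′ j′ eq′) →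
          fractional (monic-* t t′) (integral-mulP D D′ i i′)
            (integral-addP (mulP p D′) (mulP p′ D) (integral-mulP p D′ j i′) (integral-mulP p′ D j′ i)) (begin
              ι (mulP D D′) * (x + y)
                ≈⟨ *-congʳ (*-homo D D′) ⟩
              ι D * ι D′ * (x + y)
                ≈⟨ solve 4 (λ d d′ x y → d :* d′ :* (x :+ y) := d :* x :* d′ :+ d′ :* y :* d) refl _ _ _ _ ⟩
              ι D * x * ι D′ + ι D′ * y * ι D
                ≈⟨ +-cong (trans (*-congʳ eq) (sym (*-homo p D′))) (trans (*-congʳ eq′) (sym (*-homo p′ D))) ⟩
              ι (mulP p D′) + ι (mulP p′ D)
                ≈⟨ +-homo (mulP p D′) (mulP p′ D) ⟨
              ι (addP (mulP p D′) (mulP p′ D)) ∎) }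
      ; mul   = λ { {x} {y} (fractional {D} {p} t i j eq) (fractional {D′} {p′} t′ i′ j′ eq′) →
          fractional (monic-* t t′) (integral-mulP D D′ i i′) (integral-mulP p p′ j j′) (begin
              ι (mulP D D′) * (x * y)
                ≈⟨ *-congʳ (*-homo D D′) ⟩
              ι D * ι D′ * (x * y)
                ≈⟨ solve 4 (λ d d′ x y → d :* d′ :* (x :* y) := d :* x :* (d′ :* y)) refl _ _ _ _ ⟩
              ι D * x * (ι D′ * y)
                ≈⟨ *-cong eq eq′ ⟩
              ι p * ι p′
                ≈⟨ *-homo p p′ ⟨
              ι (mulP p p′) ∎) }
      ; neg   = λ { (fractional {p = p} t i j eq) → fractional {p = negP p} t i (integral-negP p j)
          (trans (sym (-‿distribʳ-* _ _)) (trans (-‿cong eq) (sym (-‿homo p)))) }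
      }
      where
      monic-* : ∀ {p q m n} → HasTop p m A.1# → HasTop q n A.1# → HasTop (mulP p q) (m ℕ.+ n) A.1#
      monic-* t t′ = ≋-top P.refl (A.*-identityʳ A.1#) (*-top t t′)

    private
      module Q = IsSubring fractional-subring
      module S = SubringSeries K fractional-subring

    F-fractional : ∀ n → Fractional (F n)
    F-fractional zero    = Q.resp (sym F-zero) Q.has-1
    F-fractional (suc n) with F-fractional n
    ... | fractional {D} {p} t i j eq = fractional
      (≋-top P.refl (A.*-identityʳ A.1#) (*-top t (bracket-top n)))
      (integral-mulP D (bracket X (suc n)) i (integral-bracket (suc n))) j (begin
        ι (mulP D (bracket X (suc n))) * F (suc n)        ≈⟨ *-congʳ (*-homo D _) ⟩
        ι D * ι (bracket X (suc n)) * F (suc n)           ≈⟨ *-assoc _ _ _ ⟩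
        ι D * (ι (bracket X (suc n)) * F (suc n))         ≈⟨ *-congˡ (F-suc n) ⟩
        ι D * F n                                         ≈⟨ eq ⟩
        ι p ∎)

    -- The two inductions interleave: the product of n factors involves e 1, ..., e n only, and
    -- together with F it determines e (n+1).
    partialProduct-fractional : ∀ n → S.Over (partialProduct n)
    e-fractional : ∀ n → Fractional (e (suc n))

    partialProduct-fractional zero    = S.over-one
    partialProduct-fractional (suc n) = S.over-⋆ (partialProduct-fractional n)
      (λ k → Q.add (S.over-one k) (S.over-mono (suc n) (e-fractional n) k))

    e-fractional n = Q.resp (begin
      F (suc n) + - a              ≈⟨ +-congʳ (expansion-rec {F} F-zero expands n) ⟨
      a + e (suc n) + - a          ≈⟨ solve 3 (λ a b c → a :+ b :+ c := b :+ (a :+ c)) refl _ _ _ ⟩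
      e (suc n) + (a + - a)        ≈⟨ trans (+-congˡ (-‿inverseʳ a)) (+-identityʳ _) ⟩
      e (suc n) ∎) (Q.add (F-fractional (suc n)) (Q.neg (partialProduct-fractional n (suc n))))
      where a = partialProduct n (suc n)

    -- Injectivity of `ι` turns the two representations of e (n+1) into D·r = u·p. The right side is
    -- integral and D is monic, so `over-quotient` applies to r.
    numerator-integral : ∀ {n U c} (r : Numerator (suc n) U (e (suc n)) c) → Over ⟦ poly r ⟧
    numerator-integral {n} {U} (numerator r cleared tr) with e-fractional n
    ... | fractional {D} {p} t i j eq = over-quotient (series-top t) i (suc U) ⟦ r ⟧ (coeff> tr)
      (λ k → I.resp (A.trans (at (coeffs-≐ D*r) k) (at (⟦⟧-mulP D r) k))
        (integral-mulP (u (suc n)) p (integral-prod (λ j → integral-bracket (gcd j (suc n))) (suc n)) j k))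
      where
      D*r : mulP (u (suc n)) p ≋ mulP D r
      D*r = injective (begin
        ι (mulP (u (suc n)) p)                    ≈⟨ *-homo (u (suc n)) p ⟩
        ι (u (suc n)) * ι p                       ≈⟨ *-congˡ eq ⟨
        ι (u (suc n)) * (ι D * e (suc n))         ≈⟨ solve 3 (λ a d x → a :* (d :* x) := d :* (a :* x)) refl _ _ _ ⟩
        ι D * (ι (u (suc n)) * e (suc n))         ≈⟨ *-congˡ cleared ⟩
        ι D * ι r                                 ≈⟨ *-homo D r ⟨
        ι (mulP D r) ∎)

-- Maps of coefficients, and the rationals as base ring.

module PolyMap {A B : Set} {0A : A} {_+A_ _*A_ : A → A → A} {0B : B} {_+B_ _*B_ : B → B → B}
  (h : A → B) (h-0 : h 0A ≡ 0B) (h-+ : ∀ x y → h (x +A y) ≡ h x +B h y) (h-* : ∀ x y → h (x *A y) ≡ h x *B h y) where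
  private
    module PA = PolyOps 0A _+A_ _*A_
    module PB = PolyOps 0B _+B_ _*B_

  map-addP : ∀ p q → map h (PA.addP p q) ≡ PB.addP (map h p) (map h q)
  map-addP []      q       = ≡.refl
  map-addP (a ∷ p) []      = ≡.refl
  map-addP (a ∷ p) (b ∷ q) = ≡.cong₂ _∷_ (h-+ a b) (map-addP p q)

  map-scaleP : ∀ a p → map h (PA.scaleP a p) ≡ PB.scaleP (h a) (map h p)
  map-scaleP a []      = ≡.refl
  map-scaleP a (b ∷ p) = ≡.cong₂ _∷_ (h-* a b) (map-scaleP a p)

  map-mulP : ∀ p q → map h (PA.mulP p q) ≡ PB.mulP (map h p) (map h q)
  map-mulP []      q = ≡.refl
  map-mulP (a ∷ p) q = ≡.trans (map-addP (PA.scaleP a q) (0A ∷ PA.mulP p q))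
    (≡.cong₂ PB.addP (map-scaleP a q) (≡.cong₂ _∷_ h-0 (map-mulP p q)))

  coeff-map : ∀ k p → PB.coeff k (map h p) ≡ h (PA.coeff k p)
  coeff-map k       []      = ≡.sym h-0
  coeff-map zero    (a ∷ p) = ≡.refl
  coeff-map (suc k) (a ∷ p) = coeff-map k p

ℚ-ring : CommutativeRing 0ℓ 0ℓ
ℚ-ring = ℚ.+-*-commutativeRing

ℚ-domain : IsDiscreteDomain ℚ-ring
ℚ-domain = record
  { 1≉0              = λ ()
  ; _≟0              = λ a → a ℚ.≟ 0ℚ
  ; no-zero-divisors = no-zero-divisors
  }
  where
  no-zero-divisors : ∀ {a b} → a ℚ.* b ≡ 0ℚ → b ≢ 0ℚ → a ≡ 0ℚ
  no-zero-divisors {a} {b} ab≡0 b≢0 = begin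
    a                       ≡⟨ ℚ.*-identityʳ a ⟨
    a ℚ.* 1ℚ                ≡⟨ ≡.cong (a ℚ.*_) (ℚ.*-inverseʳ b) ⟨
    a ℚ.* (b ℚ.* ℚ.1/ b)    ≡⟨ ℚ.*-assoc a b _ ⟨
    a ℚ.* b ℚ.* ℚ.1/ b      ≡⟨ ≡.cong (ℚ._* ℚ.1/ b) ab≡0 ⟩
    0ℚ ℚ.* ℚ.1/ b           ≡⟨ ℚ.*-zeroˡ (ℚ.1/ b) ⟩
    0ℚ ∎
    where
    open ≡.≡-Reasoning
    instance _ = ℚ.≢-nonZero b≢0

IsInteger : ℚ → Set
IsInteger x = ∃[ z ] x ≡ z ℚ./ 1

-- Operations on ℚ normalise by a gcd; among unnormalised rationals the denominator stays 1 and the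
-- identities reduce to ones in ℤ.
ℤ-subring : IsSubring ℚ-ring IsInteger
ℤ-subring = record
  { resp  = λ { ≡.refl i → i }
  ; has-0 = + 0 , ≡.refl
  ; has-1 = + 1 , ≡.refl
  ; add   = λ { (y , ≡.refl) (z , ≡.refl) → y ℤ.+ z , ℚ.toℚᵘ-injective (begin
      ℚ.toℚᵘ (y ℚ./ 1 ℚ.+ z ℚ./ 1)               ≈⟨ ℚ.toℚᵘ-homo-+ (y ℚ./ 1) (z ℚ./ 1) ⟩
      ℚ.toℚᵘ (y ℚ./ 1) ℚᵘ.+ ℚ.toℚᵘ (z ℚ./ 1)     ≈⟨ ℚᵘ.+-cong (embed y) (embed z) ⟩
      mkℚᵘ y 0 ℚᵘ.+ mkℚᵘ z 0
        ≈⟨ *≡* (≡.cong (ℤ._* + 1) (≡.cong₂ ℤ._+_ (ℤ.*-identityʳ y) (ℤ.*-identityʳ z))) ⟩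
      mkℚᵘ (y ℤ.+ z) 0                           ≈⟨ embed (y ℤ.+ z) ⟨
      ℚ.toℚᵘ ((y ℤ.+ z) ℚ./ 1) ∎) }
  ; mul   = λ { (y , ≡.refl) (z , ≡.refl) → y ℤ.* z , ℚ.toℚᵘ-injective (begin
      ℚ.toℚᵘ ((y ℚ./ 1) ℚ.* (z ℚ./ 1))               ≈⟨ ℚ.toℚᵘ-homo-* (y ℚ./ 1) (z ℚ./ 1) ⟩
      ℚ.toℚᵘ (y ℚ./ 1) ℚᵘ.* ℚ.toℚᵘ (z ℚ./ 1)     ≈⟨ ℚᵘ.*-cong (embed y) (embed z) ⟩
      mkℚᵘ (y ℤ.* z) 0                           ≈⟨ embed (y ℤ.* z) ⟨
      ℚ.toℚᵘ ((y ℤ.* z) ℚ./ 1) ∎) }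
  ; neg   = λ { (y , ≡.refl) → ℤ.- y , ℚ.toℚᵘ-injective (begin
      ℚ.toℚᵘ (ℚ.- (y ℚ./ 1))                     ≈⟨ ℚ.toℚᵘ-homo‿- (y ℚ./ 1) ⟩
      ℚᵘ.- ℚ.toℚᵘ (y ℚ./ 1)                      ≈⟨ ℚᵘ.-‿cong (embed y) ⟩
      mkℚᵘ (ℤ.- y) 0                             ≈⟨ embed (ℤ.- y) ⟨
      ℚ.toℚᵘ ((ℤ.- y) ℚ./ 1) ∎) }
  }
  where
  open SetoidReasoning ℚᵘ.≃-setoid
  embed : ∀ z → ℚ.toℚᵘ (z ℚ./ 1) ℚᵘ.≃ mkℚᵘ z 0
  embed z = ℚ.toℚᵘ-fromℚᵘ (mkℚᵘ z 0)

-- Characteristic zero enters here: the sum of ones is positive, hence invertible.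
ℚ-nat-inverse : ∀ n → ∃[ y ] y ℚ.* Bracket.bracket ℚ-ring 1ℚ (suc n) ≡ 1ℚ
ℚ-nat-inverse n = ℚ.1/ nat (suc n) , ℚ.*-inverseˡ (nat (suc n))
  where
  nat = Bracket.bracket ℚ-ring 1ℚ
  nonNegative : ∀ n → ℚ.NonNegative (nat n)
  positive : ∀ n → ℚ.Positive (nat (suc n))
  nonNegative zero    = _
  nonNegative (suc n) = ℚ.pos⇒nonNeg (nat (suc n)) ⦃ positive n ⦄
  positive n = ≡.subst (λ x → ℚ.Positive (1ℚ ℚ.+ x)) (≡.sym (ℚ.*-identityˡ (nat n)))
    (ℚ.pos+nonNeg⇒pos 1ℚ (nat n) ⦃ nonNegative n ⦄)
  instance nat≢0 = ℚ.pos⇒nonZero (nat (suc n)) ⦃ positive n ⦄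

-- Translating the polynomials, gcds and signs of the statement.

private
  module P = CommutativeRing (ListPoly.polyRing ℚ-ring)

open ListPoly ℚ-ring using (_≋_; coeffs; coeffs-≐; polyRing; ⟦_⟧; ⟦⟧-addP; ⟦⟧-negP; negP)
open PowerSeries using (ext; at)
open DomainPoly ℚ-ring ℚ-domain
open Divisors polyRing using (prod; prod-cong; gcdProduct; bracket-gcd; bracket-∣)

zeros : ∀ {p} → All (_≡ 0ℚ) p → ∀ k → coeffₚ k p ≡ 0ℚ
zeros []         k       = ≡.refl
zeros (a≡0 ∷ ps) zero    = a≡0
zeros (a≡0 ∷ ps) (suc k) = zeros ps k

all-zero : ∀ p → (∀ k → coeffₚ k p ≡ 0ℚ) → All (_≡ 0ℚ) p
all-zero []      z = []
all-zero (a ∷ p) z = z 0 ∷ all-zero p (λ k → z (suc k))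

≈ₚ⇒≋ : ∀ {p q} → p ≈ₚ q → p ≋ q
≈ₚ⇒≋ {p} {q} z = x∙y⁻¹≈ε⇒x≈y p q (coeffs (ext (zeros z)))
  where open Algebra.Properties.Ring P.ring

≋⇒≈ₚ : ∀ {p q} → p ≋ q → p ≈ₚ q
≋⇒≈ₚ {p} {q} p≋q = all-zero (p +ₚ (-ₚ q)) (at (coeffs-≐ (x≈y⇒x∙y⁻¹≈ε p≋q)))
  where open Algebra.Properties.Ring P.ring

qint-bracket : ∀ n → qint n ≋ bracket X n
qint-bracket n = P.sym (bracket-X n)

qfact-top : ∀ n → ∃[ m ] HasTop (qfact n) m 1ℚ
qfact-top zero    = 0 , one-top
qfact-top (suc n) = _ , ≋-top (P.*-congˡ {qfact n} (bracket-X (suc n))) (ℚ.*-identityʳ 1ℚ)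
  (*-top (proj₂ (qfact-top n)) (bracket-top n))

-- g divides [gcd] by `bracket-gcd`, [gcd] divides g by the universal property of g, and both are
-- monic.
monicGcd-bracket : ∀ j n {g} → IsMonicGcd (qint (suc j)) (qint n) g → g ≋ bracket X (gcd (suc j) n)
monicGcd-bracket j n {g} (monic , (a , ga) , (b , gb) , greatest) =
  monic-antisym (last-top g monic) (proj₂ (bracket-gcd-monic n j)) g∣h (≈ₚ⇒≋ (proj₂ h∣g))
  where
  open Algebra.Properties.Monoid.Divisibility P.*-monoid using (_∣_; _,_; _∣ʳ_)
  h = bracket X (gcd (suc j) n)
  from-∣ₚ : ∀ {c m} d → (c *ₚ d) ≈ₚ qint m → c ∣ bracket X m
  from-∣ₚ {c} {m} d eq = d , P.trans (P.*-comm d c) (P.trans (≈ₚ⇒≋ eq) (qint-bracket m))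
  to-∣ₚ : ∀ {m} → h ∣ bracket X m → h ∣ₚ qint m
  to-∣ₚ {m} (d , eq) = d , ≋⇒≈ₚ (P.trans (P.*-comm h d) (P.trans eq (bracket-X m)))
  g∣ : g ∣ h
  g∣ = bracket-gcd j n (from-∣ₚ a ga) (from-∣ₚ b gb)
  g∣h : g *ₚ _∣ʳ_.quotient g∣ ≋ h
  g∣h = P.trans (P.*-comm g _) (_∣ʳ_.equality g∣)
  h∣g : h ∣ₚ g
  h∣g = greatest h (to-∣ₚ (bracket-∣ X (gcd[m,n]∣m (suc j) n))) (to-∣ₚ (bracket-∣ X (gcd[m,n]∣n (suc j) n)))

prodTo-prod : ∀ g n → prodTo g n ≡ prod g n
prodTo-prod g zero    = ≡.refl
prodTo-prod g (suc n) = ≡.cong (_*ₚ g (suc n)) (prodTo-prod g n)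

prodTo-gcdProduct : ∀ g n → (∀ j → 1 ≤ j → j ≤ n → IsMonicGcd (qint j) (qint n) (g j)) → prodTo g n ≋ gcdProduct X n
prodTo-gcdProduct g n g-gcd = P.trans (P.reflexive (prodTo-prod g n)) (prod-cong n λ
  { (suc j) 1≤j j≤n → monicGcd-bracket j n (g-gcd (suc j) 1≤j j≤n) })

signP-sign : ∀ n → signP n ≋ sign n
signP-sign zero    = P.refl
signP-sign (suc n) = P.trans (P.-‿cong (signP-sign n)) (P.sym (-1*x≈-x (sign n)))
  where open Algebra.Properties.Ring P.ring

-- The list is rebuilt with exactly m + 1 entries, because the list giving the coefficients may end
-- in zeros while `MonicℤPoly` inspects the last stored entry.
monicℤ : ∀ m (f : ℕ → ℚ) → PowerSeries.Top ℚ-ring f m 1ℚ → (∀ k → IsInteger (f k)) →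
         ∃[ P ] MonicℤPoly P × (∀ k → coeffₚ k (embedℤ P) ≡ f k)
monicℤ zero f (f0 , f>) int = + 1 ∷ [] , ≡.refl , λ { zero → ≡.sym f0 ; (suc k) → ≡.sym (f> (suc k) (s≤s z≤n)) }
monicℤ (suc m) f (fm , f>) int with monicℤ m (λ k → f (suc k)) (fm , λ k m<k → f> (suc k) (s≤s m<k)) (λ k → int (suc k))
-- The tail must be seen to be nonempty before `last` of the longer list reduces to `last` of the
-- tail.
... | []    , ()    , _
... | a ∷ p , monic , eq = proj₁ (int 0) ∷ a ∷ p , monic , λ { zero → ≡.sym (proj₂ (int 0)) ; (suc k) → eq k }

-- Lifting the expansion of the statement to the fraction ring.

open Fractions polyRing

-- `_≈F_` is not transitive on arbitrary pairs, since denominators may vanish, so the argument runs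
-- on `Fraction`. Forgetting regularity commutes with the operations definitionally, which makes the
-- products of the statement images of products there.
toFrac : Fraction → Frac
toFrac (fraction a b _) = a ÷ b

module KOps = PolyOps (ι []) _⊕_ _⊗_
module K = CommutativeRing fractionRing
module KPoly = ListPoly fractionRing
open PowerSeries fractionRing using (_≐_; ≐-trans; ⋆-cong; mono)
open LogDerivative.PowerProduct fractionRing using (φ; partialProduct)

open PolyMap {0A = ι []} {_⊕_} {_⊗_} {0F} {_+F_} {_*F_} toFrac ≡.refl (λ _ _ → ≡.refl) (λ _ _ → ≡.refl)

-- The index is shifted: k zeros between 1 and c place c at exponent k + 1.
factorK : ℕ → Fraction → List Fraction
factorK k c = K.1# ∷ (replicate k K.0# ++ (c ∷ []))

factorK-φ : ∀ (e : ℕ → Fraction) n → KPoly.⟦ factorK n (e (suc n)) ⟧ ≐ φ e (suc n)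
factorK-φ e n = ext λ { zero → K.sym (K.+-identityʳ K.1#) ; (suc k) → K.trans (go n k) (K.sym (K.+-identityˡ _)) }
  where
  c = e (suc n)
  go : ∀ n k → KOps.coeff k (replicate n K.0# ++ (c ∷ [])) K.≈ mono n c k
  go zero    zero    = K.refl
  go zero    (suc k) = K.refl
  go (suc n) zero    = K.refl
  go (suc n) (suc k) = go n k

prodFactorsK : (ℕ → Fraction) → ℕ → List Fraction
prodFactorsK e zero    = K.1# ∷ []
prodFactorsK e (suc n) = KOps.mulP (prodFactorsK e n) (factorK n (e (suc n)))

prodFactorsK-partialProduct : ∀ e n → KPoly.⟦ prodFactorsK e n ⟧ ≐ partialProduct e n
prodFactorsK-partialProduct e zero    = KPoly.⟦1⟧
prodFactorsK-partialProduct e (suc n) = ≐-trans (KPoly.⟦⟧-mulP (prodFactorsK e n) (factorK n (e (suc n))))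
  (⋆-cong (prodFactorsK-partialProduct e n) (factorK-φ e n))

module _ (e : ℕ → Frac) (e-ppe : IsPPE-qexp e) where

  den-regular : ∀ n → Regular (den (e (suc n)))
  den-regular n with zero-or-top (den (e (suc n)))
  ... | inj₁ z = contradiction (≋⇒≈ₚ z) (proj₁ e-ppe (suc n) (s≤s z≤n))
  ... | inj₂ (m , c , c≢0 , t) = top-regular t c≢0

  eK : ℕ → Fraction
  -- `IsPPE-qexp` leaves the denominator of `e 0` free to vanish; 0 is a default, as the factors
  -- start at index 1.
  eK zero    = K.0#
  eK (suc n) = fraction (num (e (suc n))) (den (e (suc n))) (den-regular n)

  prodFactors-map : ∀ n → prodFactors e n ≡ map toFrac (prodFactorsK eK n)
  prodFactors-map zero    = ≡.refl
  prodFactors-map (suc n) = ≡.trans (≡.cong₂ SerOps.mulP (prodFactors-map n) (factor-map n))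
    (≡.sym (map-mulP (prodFactorsK eK n) (factorK n (eK (suc n)))))
    where
    factor-map : ∀ n → factor (suc n) (e (suc n)) ≡ map toFrac (factorK n (eK (suc n)))
    factor-map n = ≡.cong (1F ∷_) (≡.sym (≡.trans (map-++ toFrac (replicate n K.0#) _)
      (≡.cong (_++ (e (suc n) ∷ [])) (map-replicate toFrac n K.0#))))

  fact⁻¹ : ℕ → Fraction
  fact⁻¹ n = fraction (1ℚ ∷ []) (qfact n) (top-regular (proj₂ (qfact-top n)) (λ ()))

  qExponentialExpansion : QExponentialExpansion ℚ-ring ℚ-domain
  qExponentialExpansion = record
    { K       = fractionRing
    ; ι       = ι
    ; ι-mono  = ι-isRingMonomorphism
    ; J       = λ k → fraction (1ℚ ∷ []) (bracket X (suc k)) (top-regular (bracket-top k) (λ ()))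
    ; J-inv   = λ k → cross (solve 1 (λ b → con 1 :* b :* con 1 := con 1 :* (b :* con 1)) P.refl (bracket X (suc k)))
    ; e       = eK
    ; F       = fact⁻¹
    ; F-zero  = cross P.refl
    ; F-suc   = λ k → cross (P.trans (P.*-congʳ (P.*-congʳ (P.sym (qint-bracket (suc k)))))
        (solve 2 (λ b f → b :* con 1 :* f := con 1 :* (con 1 :* (f :* b))) P.refl (qint (suc k)) (qfact k)))
    ; expands = λ n → K.trans (K.sym (at (prodFactorsK-partialProduct eK (suc n)) (suc n))) (expands n)
    }
    where
    open NatSolver P.commutativeSemiring using (solve; con; _:=_; _:+_; _:*_)
    expands : ∀ n → KOps.coeff (suc n) (prodFactorsK eK (suc n)) K.≈ fact⁻¹ (suc n)
    -- Rewriting the lists as images under `toFrac` turns the hypothesis into the cross-multiplied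
    -- equality of two fractions.
    expands n = cross (≈ₚ⇒≋ (≡.subst (_≈F invQFact (suc n))
      (≡.trans (≡.cong (SerOps.coeff (suc n)) (prodFactors-map (suc n))) (coeff-map (suc n) (prodFactorsK eK (suc n))))
      (proj₂ e-ppe (suc n) (s≤s z≤n))))

theorem4p2 : (e : ℕ → Frac) → IsPPE-qexp e →
    (n : ℕ) → 1 < n →
    (g : ℕ → Poly) → (∀ j → 1 ≤ j → j ≤ n → IsMonicGcd (qint j) (qint n) (g j)) →
    ∃[ P ] (MonicℤPoly P ×
    ((signP n *ₚ (prodTo g n *ₚ num (e n))) ≈ₚ (embedℤ P *ₚ den (e n))))
theorem4p2 e e-ppe n@(suc n-1) 1<n g g-gcd = Pℤ , P-monic , ≋⇒≈ₚ (begin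
  signP n *ₚ (prodTo g n *ₚ a)
    ≈⟨ P.*-cong (signP-sign n) (P.*-congʳ {a} (prodTo-gcdProduct g n g-gcd)) ⟩
  sign n *ₚ (gcdProduct X n *ₚ a)
    ≈⟨ P.*-congˡ {sign n} (P.*-identityʳ (gcdProduct X n *ₚ a)) ⟨
  sign n *ₚ ((gcdProduct X n *ₚ a) *ₚ (1ℚ ∷ []))
    -- Cross-multiplying `cleared` keeps the denominators 1 of the two embedded polynomials, hence
    -- the units inserted before and removed after.
    ≈⟨ P.*-congˡ {sign n} (cross-≈ cleared) ⟩
  sign n *ₚ (r *ₚ ((1ℚ ∷ []) *ₚ b))
    ≈⟨ P.*-congˡ {sign n} (P.*-congˡ {r} (P.*-identityˡ b)) ⟩
  sign n *ₚ (r *ₚ b)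
    ≈⟨ P.*-assoc (sign n) r b ⟨
  (sign n *ₚ r) *ₚ b
    ≈⟨ P.*-congʳ {b} {embedℤ Pℤ} {sign n *ₚ r} (coeffs (ext P-coeff)) ⟨
  embedℤ Pℤ *ₚ b ∎)
  where
  open SetoidReasoning P.setoid
  module Num = Numerators ℚ-ring ℚ-domain (qExponentialExpansion e e-ppe)
  module Int = Num.Integrality ℤ-subring
  a = num (e n)
  b = den (e n)
  claim = Num.numerator-claim ℚ-nat-inverse n 1<n
  open Num.Numerator (proj₂ (proj₂ claim)) renaming (poly to r)
  open Bracket ℚ-ring using () renaming (_^_ to _^ℚ_)
  -- r has leading coefficient (-1)ⁿ, so the sign in front makes it 1.
  signs : ∀ n → ((ℚ.- 1ℚ) ^ℚ n) ℚ.* ((ℚ.- 1ℚ) ^ℚ n) ≡ 1ℚ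
  signs zero    = ≡.refl
  signs (suc n) = ≡.trans
    (solve 2 (λ s p → (s :* p) :* (s :* p) := s :* (s :* (p :* p))) ≡.refl (ℚ.- 1ℚ) ((ℚ.- 1ℚ) ^ℚ n))
    (≡.trans (-1*-1* _) (signs n))
    where open NatSolver (CommutativeRing.commutativeSemiring ℚ-ring) using (solve; _:=_; _:*_)
  integral = monicℤ (proj₁ claim) ⟦ sign n *ₚ r ⟧
    (series-top (≋-top P.refl (signs n) (*-top (sign-top n) poly-top)))
    (Int.integral-mulP (sign n) r (Int.integral-sign n) (Int.numerator-integral (proj₂ (proj₂ claim))))
  Pℤ = proj₁ integral
  P-monic = proj₁ (proj₂ integral)
  P-coeff = proj₂ (proj₂ integral)
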